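{- (i) For every integer $n\geq 5$, $ar(n,\mathcal{T})=\lfloor n/3\rfloor+2$. (ii) $ar(6,\mathcal{M})=11$ and $ar(n,\mathcal{M})=3$ for every $n\geq 7$. (iii) For every integer $n\geq 7$, $ar(n,\mathcal{L})=n$.
   Context: For a 3-graph $G$ and $n\geq |V(G)|$, the anti-Ramsey number $ar(n,G)$ is the minimum integer $k$ such that every edge-coloring of the complete 3-uniform hypergraph $K^{(3)}_n$ using at least $k$ colors contains a rainbow copy of $G$ (a copy all of whose edges have distinct colors). The tight path $\mathcal{T}$ has edges $\{v_1v_2v_3,v_2v_3v_4,v_3v_4v_5\}$; the messy path $\mathcal{M}$ has edges $\{v_1v_2v_3,v_2v_3v_4,v_4v_5v_6\}$; the loose path $\mathcal{L}$ has edges $\{v_1v_2v_3,v_3v_4v_5,v_5v_6v_7\}$ (all $v_i$ distinct). -}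

module Defs where

open import Data.Nat using (ℕ; _≤_; _<_; _/_; _+_)
open import Data.Fin using (Fin)
open import Data.Fin using (#_)
open import Data.Product using (_×_; _,_; Σ; ∃)
open import Data.List using (List; []; _∷_; map)
open import Data.List.Relation.Unary.Unique.Propositional using (Unique)
open import Relation.Binary.PropositionalEquality using (_≡_; _≢_)
open import Function.Definitions using (Injective)

-- A 3-uniform hypergraph on the vertex set Fin v, given by its list of
-- edges; each edge is written as a triple of (distinct) vertices.
record Hypergraph3 : Set where
  field
    nv    : ℕ
    edges : List (Fin nv × Fin nv × Fin nv)
open Hypergraph3 public

-- An edge-colouring of the complete 3-graph K_n^(3) with colours in ℕ:
-- a function on ordered triples that is invariant under permuting the
-- three arguments (so it is a function of the 3-set {a,b,c}).  Its values
-- on triples with repeated vertices are irrelevant (never inspected).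
record Colouring (n : ℕ) : Set where
  field
    col    : Fin n → Fin n → Fin n → ℕ
    swap12 : ∀ a b c → col a b c ≡ col b a c
    swap23 : ∀ a b c → col a b c ≡ col a c b
open Colouring public

-- a triple of pairwise distinct vertices = (an ordering of) an edge of K_n^(3)
record DTriple (n : ℕ) : Set where
  constructor dtriple
  field
    t1 t2 t3 : Fin n
    d12 : t1 ≢ t2
    d13 : t1 ≢ t3
    d23 : t2 ≢ t3
open DTriple public

colOf : ∀ {n} → Colouring n → DTriple n → ℕ
colOf χ t = col χ (t1 t) (t2 t) (t3 t)

UsesAtLeast : ∀ {n} → Colouring n → ℕ → Set
UsesAtLeast {n} χ k =
  Σ (Fin k → DTriple n) λ f → ∀ i j → colOf χ (f i) ≡ colOf χ (f j) → i ≡ j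

HasRainbowCopy : ∀ {n} → Colouring n → Hypergraph3 → Set
HasRainbowCopy {n} χ G =
  Σ (Fin (nv G) → Fin n) λ φ →
    Injective _≡_ _≡_ φ ×
    Unique (map (λ { (a , b , c) → col χ (φ a) (φ b) (φ c) }) (edges G))

Forces : ℕ → Hypergraph3 → ℕ → Set
Forces n G k = (χ : Colouring n) → UsesAtLeast χ k → HasRainbowCopy χ G

ArEq : ℕ → Hypergraph3 → ℕ → Set
ArEq n G k = Forces n G k × (∀ j → Forces n G j → k ≤ j)

tightPath : Hypergraph3
tightPath = record { nv = 5 ; edges = (# 0 , # 1 , # 2) ∷ (# 1 , # 2 , # 3) ∷ (# 2 , # 3 , # 4) ∷ [] }

messyPath : Hypergraph3
messyPath = record { nv = 6 ; edges = (# 0 , # 1 , # 2) ∷ (# 1 , # 2 , # 3) ∷ (# 3 , # 4 , # 5) ∷ [] }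

loosePath : Hypergraph3
loosePath = record { nv = 7 ; edges = (# 0 , # 1 , # 2) ∷ (# 2 , # 3 , # 4) ∷ (# 4 , # 5 , # 6) ∷ [] }

{-# OPTIONS --safe #-}
module Submission where

-- A rainbow-free colouring is studied through rainbow-free configurations on at most nine vertices.
--
-- Tight path: two intersecting triples of distinct colours a, b yield a "kite" xyu, xyv with the same colours;
-- a triple of a third colour has at most one vertex in {x, y, u, v}, and contains neither x nor y.  Hence the
-- graph "some two representatives intersect" on the colours has no two disjoint edges and no triangle, so one
-- representative can be removed to leave n/3 + 1 disjoint triples, which do not fit into n vertices.
--
-- Messy path: if disjoint triples have distinct colours, there is no third colour.  So disjoint triples have
-- equal colours: for n = 6 this leaves at most ten colours, and for n ≥ 7 the Kneser graph is connected.
--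
-- Loose path: if disjoint triples e, f have colours a ≠ b, every triple of a third colour shares exactly two
-- vertices with e or with f, and always with the same one, say e; two triples of further distinct colours share
-- exactly two vertices as well.  Thus e and n - 2 representatives are n - 1 ≥ 6 triples that pairwise share two
-- vertices, which is impossible.
--
-- The finite configurations are refuted by a verified case analysis: colours are merged so that only the
-- prescribed ones remain, the colours of a few listed triples are guessed in turn, and every branch contains
-- a rainbow copy.

open import Defs
open import Data.Bool using (Bool; true; false; T; _∨_; _∧_; if_then_else_)
import Data.Bool.ListAction as Bools
open import Data.Bool.Properties using (T-∨; ∨-comm; T?)
open import Data.Empty using (⊥; ⊥-elim)
open import Data.Fin using (Fin; zero; suc; #_; _<_; toℕ; fromℕ<; inject≤; punchIn; remQuot; combine)
open import Data.Fin.Properties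
  using (all?; any?; _<?_; <-cmp; <⇒≢; suc-injective; pigeonhole; injective⇒≤; punchIn-injective; punchInᵢ≢i;
         combine-remQuot; toℕ-injective; toℕ-fromℕ<; toℕ<n; inject≤-injective)
  renaming (_≟_ to _≟F_)
open import Data.List using (List; []; _∷_; _++_; map; concatMap; length; reverse; tabulate; upTo)
import Data.List as List
open import Data.List.Membership.Propositional using (_∈_; _∉_)
open import Data.List.Membership.Propositional.Properties using (∈-lookup; ∈-upTo⁺; ∈-map⁻; ∈-tabulate⁻)
import Data.List.Membership.DecPropositional as DecMembership
open import Data.List.Properties using (length-tabulate; map-cong)
open import Data.List.Relation.Binary.Disjoint.Propositional using (Disjoint)
open import Data.List.Relation.Binary.Pointwise using (Pointwise; []; _∷_)
import Data.List.Relation.Binary.Pointwise as Pointwise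
open import Data.List.Relation.Unary.All using (All; []; _∷_)
import Data.List.Relation.Unary.All as All
import Data.List.Relation.Unary.All.Properties as Allₚ
open import Data.List.Relation.Unary.AllPairs using ([]; _∷_)
import Data.List.Relation.Unary.AllPairs as AllPairs
import Data.List.Relation.Unary.AllPairs.Properties as AllPairsₚ
open import Data.List.Relation.Unary.Any using (Any; here; there)
import Data.List.Relation.Unary.Any as Any
import Data.List.Relation.Unary.Any.Properties as Anyₚ
open import Data.List.Relation.Unary.Unique.Propositional using (Unique)
import Data.List.Relation.Unary.Unique.Propositional.Properties as Uniqueₚ
import Data.List.Relation.Unary.Unique.DecPropositional as DecUnique
open import Data.Maybe using (Maybe; just; nothing)
import Data.Maybe as Maybe
open import Data.Nat
  using (ℕ; zero; suc; _+_; _*_; _∸_; _/_; _^_; _⊓_; _≡ᵇ_; _≤_; z≤n; s≤s; z<s; s≤s⁻¹)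
  renaming (_<_ to _<ℕ_)
open import Data.Nat.Divisibility using (divides)
open import Data.Nat.DivMod using (m*n/n≡m; +-distrib-/-∣ʳ; m/n*n≤m; m≡m%n+[m/n]*n; m%n<n)
open import Data.Nat.Properties
  using (+-comm; +-assoc; +-cancelˡ-≡; +-cancelʳ-≡; +-monoˡ-<; *-monoˡ-≤; ≡ᵇ⇒≡; ≤-trans; <-trans; <-≤-trans; <⇒≱; ≮⇒≥;
         n≤1+n; n<1+n; m<n⇒m<1+n; m≤n⇒∃[o]m+o≡n)
  renaming (_≟_ to _≟ℕ_)
open import Data.Product using (_×_; _,_; proj₁; proj₂; ∃; ∃₂)
open import Data.Product.Properties using (≡-dec)
open import Data.Sum using (_⊎_; inj₁; inj₂; [_,_]′)
open import Data.Unit using (tt)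
open import Data.Vec using (Vec; []; _∷_; _[_]≔_; replicate)
import Data.Vec as Vec
open import Data.Vec.Properties using (lookup∘tabulate)
import Data.Vec.Relation.Unary.AllPairs as VecAllPairs
open import Data.Vec.Relation.Unary.Unique.Propositional using () renaming (Unique to VecUnique)
import Data.Vec.Relation.Unary.Unique.Propositional.Properties as VecUniqueₚ
open import Function using (_∘_)
open import Function.Bundles using (Equivalence)
open import Function.Definitions using (Injective)
open import Relation.Binary.Definitions using (tri<; tri≈; tri>)
open import Relation.Binary.PropositionalEquality
  using (_≡_; _≢_; refl; sym; trans; cong; cong₂; subst; ≢-sym)
open import Relation.Nullary using (¬_; Dec; yes; no; does; contradiction)
open import Relation.Nullary.Decidable
  using (_×-dec_; _⊎-dec_; _→-dec_; ¬?; map′; decidable-stable; toWitness; True)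

-- Refuting finite configurations

Triple : ℕ → Set
Triple m = Fin m × Fin m × Fin m

_≟T_ : ∀ {m} (s t : Triple m) → Dec (s ≡ t)
_≟T_ = ≡-dec _≟F_ (≡-dec _≟F_ _≟F_)

lookup-injective : ∀ {A : Set} {xs : List A} → Unique xs →
  ∀ {i j} → List.lookup xs i ≡ List.lookup xs j → i ≡ j
lookup-injective (_ ∷ _)  {zero}  {zero}  _  = refl
lookup-injective (x ∷ _)  {zero}  {suc j} eq = contradiction eq (All.lookup x (∈-lookup j))
lookup-injective (x ∷ _)  {suc i} {zero}  eq = contradiction (sym eq) (All.lookup x (∈-lookup i))
lookup-injective (_ ∷ u)  {suc i} {suc j} eq = cong suc (lookup-injective u eq)

-- Merges all colours outside the list with its last colour.
rank : List ℕ → ℕ → ℕ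
rank []       c = 0
rank (d ∷ ds) c with c ≟ℕ d
... | yes _ = length ds
... | no  _ = rank ds c

rank< : ∀ d ds c → rank (d ∷ ds) c <ℕ length (d ∷ ds)
rank< d ds c with c ≟ℕ d
rank< d ds       c | yes _ = n<1+n (length ds)
rank< d []       c | no _ = z<s
rank< d (e ∷ ds) c | no _ = m<n⇒m<1+n (rank< e ds c)

-- The numbers descend to 0, so that each triple gets the `rank` of the colour prescribed for it.
ranks : ∀ {A : Set} → List A → List (A × ℕ)
ranks []       = []
ranks (t ∷ ts) = (t , length ts) ∷ ranks ts

does-sound : {A : Set} (A? : Dec A) → T (does A?) → A
does-sound (yes a) _ = a

module _ {m : ℕ} where

  Fact : Set
  Fact = Triple m × ℕ

  -- Every ordering of a fact is stored, so that all later tests can compare ordered triples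
  -- literally.
  orders : Fact → List Fact
  orders ((a , b , c) , k) =
    ((a , b , c) , k) ∷ ((a , c , b) , k) ∷ ((b , a , c) , k) ∷
    ((b , c , a) , k) ∷ ((c , a , b) , k) ∷ ((c , b , a) , k) ∷ []

  Obeys : (Triple m → ℕ) → List Fact → Set
  Obeys κ = All (λ f → κ (proj₁ f) ≡ proj₂ f)

  bind : ∀ {v} → Fin v → Fin m → Vec (Maybe (Fin m)) v → List (Vec (Maybe (Fin m)) v)
  bind i x φ with Vec.lookup φ i
  ... | nothing = (φ [ i ]≔ just x) ∷ []
  ... | just y with x ≟F y
  ...   | yes _ = φ ∷ []
  ...   | no  _ = []

  complete : ∀ {v} → Vec (Maybe (Fin m)) v → Maybe (Vec (Fin m) v)
  complete []             = just []
  complete (nothing ∷ φ)  = nothing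
  complete (just x ∷ φ)   = Maybe.map (x ∷_) (complete φ)

  -- Skipping facts whose colour is already in `ks` leaves only rainbow candidates. Colours are
  -- pushed at the front, hence the final `reverse`.
  matches : ∀ {v} → List (Triple v) → List Fact → List ℕ → Vec (Maybe (Fin m)) v →
            List (Vec (Maybe (Fin m)) v × List ℕ)
  matches []                 F ks φ = (φ , reverse ks) ∷ []
  matches ((a , b , c) ∷ es) F ks φ = concatMap extend F
    where
    extend : Fact → List (Vec (Maybe (Fin m)) _ × List ℕ)
    extend ((x , y , z) , k) with DecMembership._∈?_ _≟ℕ_ k ks
    ... | yes _ = []
    ... | no  _ = concatMap (matches es F (k ∷ ks))
                    (concatMap (bind c z) (concatMap (bind b y) (bind a x φ)))

  module _ (G : Hypergraph3) where

    image : Vec (Fin m) (nv G) → Triple (nv G) → Triple m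
    image φ (a , b , c) = Vec.lookup φ a , Vec.lookup φ b , Vec.lookup φ c

    Rainbow : List Fact → Vec (Fin m) (nv G) → List ℕ → Set
    Rainbow F φ ks = VecUnique φ × Unique ks ×
                     Pointwise (λ e k → (image φ e , k) ∈ F) (edges G) ks

    rainbow? : ∀ F φ ks → Dec (Rainbow F φ ks)
    rainbow? F φ ks = VecAllPairs.allPairs? (λ x y → ¬? (x ≟F y)) φ ×-dec DecUnique.unique? _≟ℕ_ ks
      ×-dec Pointwise.decidable (λ e k → DecMembership._∈?_ (≡-dec _≟T_ _≟ℕ_) (image φ e , k) F) (edges G) ks

    -- A second way for a branch to die: a guess may contradict a prescribed colour, and the third
    -- triple of `five-edges` may coincide with one of the first two.
    Conflict : List Fact → Set
    Conflict F = Any (λ f → Any (λ g → proj₁ f ≡ proj₁ g × proj₂ f ≢ proj₂ g) F) F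

    conflict? : ∀ F → Dec (Conflict F)
    conflict? F = Any.any? (λ f → Any.any? (λ g → (proj₁ f ≟T proj₁ g) ×-dec ¬? (proj₂ f ≟ℕ proj₂ g)) F) F

    -- The copies proposed by matches are untrusted; rainbow? checks them.
    hasRainbow : List Fact → Bool
    hasRainbow F = Bools.any check (matches (edges G) F [] (replicate (nv G) nothing))
      where
      check : Vec (Maybe (Fin m)) (nv G) × List ℕ → Bool
      check (φ , ks) with complete φ
      ... | nothing = false
      ... | just ψ  = does (rainbow? F ψ ks)

    refute : ℕ → List (Triple m) → List Fact → Bool
    refute q []       F = hasRainbow F ∨ does (conflict? F)
    refute q (t ∷ ts) F = hasRainbow F ∨ Bools.all (λ k → refute q ts (orders (t , k) ++ F)) (upTo q)

    -- A bare `T (refute ...)` would compute away. The record keeps its parameters visible to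
    -- unification, and on closed arguments the field is filled by `_`.
    record Refutes (ts ss : List (Triple m)) : Set where
      no-eta-equality
      constructor certified
      field
        certificate : T (refute (length ts) ss (concatMap orders (ranks ts)))

    hasRainbow-sound : ∀ F → T (hasRainbow F) → ∃₂ λ φ ks → Rainbow F φ ks
    hasRainbow-sound F h with Any.satisfied (Anyₚ.any⁻ _ (matches (edges G) F [] (replicate (nv G) nothing)) h)
    ... | (φ , ks) , p with complete φ
    ...   | just ψ = ψ , ks , does-sound (rainbow? F ψ ks) p

    module _ (κ : Triple m → ℕ)
             (κ-swap₁₂ : ∀ a b c → κ (a , b , c) ≡ κ (b , a , c))
             (κ-swap₂₃ : ∀ a b c → κ (a , b , c) ≡ κ (a , c , b))
             (q : ℕ) (κ<q : ∀ t → κ t <ℕ q) where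

      KRainbow : Set
      KRainbow = ∃ λ φ → VecUnique φ × Unique (map (κ ∘ image φ) (edges G))

      orders-obey : ∀ f → κ (proj₁ f) ≡ proj₂ f → Obeys κ (orders f)
      orders-obey ((a , b , c) , k) e =
        e ∷ trans (κ-swap₂₃ a c b) e ∷ trans (κ-swap₁₂ b a c) e ∷ bca ∷ cab ∷ trans (κ-swap₁₂ c b a) bca ∷ []
        where
        bca : κ (b , c , a) ≡ k
        bca = trans (κ-swap₂₃ b c a) (trans (κ-swap₁₂ b a c) e)
        cab : κ (c , a , b) ≡ k
        cab = trans (κ-swap₁₂ c a b) (trans (κ-swap₂₃ a c b) e)

      rainbow-sound : ∀ {F} → Obeys κ F → T (hasRainbow F) → KRainbow
      rainbow-sound {F} o h with hasRainbow-sound F h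
      ... | φ , ks , uφ , uks , p = φ , uφ , subst Unique (sym (colours p)) uks
        where
        colours : ∀ {es ks} → Pointwise (λ e k → (image φ e , k) ∈ F) es ks → map (κ ∘ image φ) es ≡ ks
        colours []       = refl
        colours (f ∷ fs) = cong₂ _∷_ (All.lookup o f) (colours fs)

      conflict-sound : ∀ {F} → Obeys κ F → ¬ Conflict F
      conflict-sound o c with All.lookupAny o c
      ... | eq , c′ with All.lookupAny o c′
      ...   | eq′ , same , differ = differ (trans (sym eq) (trans (cong κ same) eq′))

      -- The proof follows the one branch whose guesses are the true colours `κ t`. All its facts
      -- hold, so it cannot end in a conflict.
      refute-sound : ∀ ss {F} → Obeys κ F → T (refute q ss F) → KRainbow
      refute-sound [] {F} o r with Equivalence.to (T-∨ {hasRainbow F}) r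
      ... | inj₁ h = rainbow-sound o h
      ... | inj₂ c = ⊥-elim (conflict-sound o (does-sound (conflict? F) c))
      refute-sound (t ∷ ts) {F} o r with Equivalence.to (T-∨ {hasRainbow F}) r
      ... | inj₁ h = rainbow-sound o h
      ... | inj₂ a = refute-sound ts (Allₚ.++⁺ (orders-obey (t , κ t) refl) o)
                       (All.lookup (Allₚ.all⁺ (λ k → refute q ts (orders (t , k) ++ F)) (upTo q) a) (∈-upTo⁺ (κ<q t)))

-- Because the colours are distinct, the search in `rank` passes over the earlier ones and stops at
-- the position counted by `ranks`.
ranks-correct : ∀ {A : Set} {f : A → ℕ} {ts cs} → Unique cs → Pointwise (λ t c → f t ≡ c) ts cs →
                All (λ p → rank cs (f (proj₁ p)) ≡ proj₂ p) (ranks ts)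
ranks-correct [] [] = []
ranks-correct {f = f} {t ∷ ts} {c ∷ cs} (c∉cs ∷ u) (refl ∷ ps) =
  rank-head ∷ All.zipWith rank-tail (ranks-correct u ps , values ps c∉cs)
  where
  rank-head : rank (f t ∷ cs) (f t) ≡ length ts
  rank-head with f t ≟ℕ f t
  ... | yes _ = sym (Pointwise.Pointwise-length ps)
  ... | no ne = contradiction refl ne
  values : ∀ {ts cs} → Pointwise (λ t c → f t ≡ c) ts cs → All (f t ≢_) cs →
           All (λ p → f t ≢ f (proj₁ p)) (ranks ts)
  values []          []       = []
  values (refl ∷ ps) (n ∷ ns) = n ∷ values ps ns
  rank-tail : ∀ {p} → rank cs (f (proj₁ p)) ≡ proj₂ p × f t ≢ f (proj₁ p) →
              rank (f t ∷ cs) (f (proj₁ p)) ≡ proj₂ p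
  rank-tail {p} (e , n) with f (proj₁ p) ≟ℕ f t
  ... | yes e′ = contradiction (sym e′) n
  ... | no _   = e

module _ {n} (χ : Colouring n) where

  colour : (xs : List (Fin n)) → Triple (length xs) → ℕ
  colour xs (a , b , c) = col χ (List.lookup xs a) (List.lookup xs b) (List.lookup xs c)

  -- ts are the triples of prescribed colours, ss the triples whose colours are guessed.
  refuted : ∀ {G} → ¬ HasRainbowCopy χ G →
            ∀ {xs} → Unique xs → ∀ {d ds} → Unique (d ∷ ds) →
            (ts ss : List (Triple (length xs))) → Pointwise (λ t c → colour xs t ≡ c) ts (d ∷ ds) →
            Refutes G ts ss → ⊥
  refuted {G} free {xs} uxs {d} {ds} ucs ts ss ps r =
    free (copy (refute-sound G κ κ-swap₁₂ κ-swap₂₃ (length ts) κ<q ss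
      (Allₚ.concat⁺ (Allₚ.map⁺ (All.map (λ {f} → orders-obey G κ κ-swap₁₂ κ-swap₂₃ (length ts) κ<q f)
                                        (ranks-correct ucs ps)))) (Refutes.certificate r)))
    where
    κ : Triple (length xs) → ℕ
    κ t = rank (d ∷ ds) (colour xs t)
    κ-swap₁₂ : ∀ a b c → κ (a , b , c) ≡ κ (b , a , c)
    κ-swap₁₂ _ _ _ = cong (rank (d ∷ ds)) (swap12 χ _ _ _)
    κ-swap₂₃ : ∀ a b c → κ (a , b , c) ≡ κ (a , c , b)
    κ-swap₂₃ _ _ _ = cong (rank (d ∷ ds)) (swap23 χ _ _ _)
    κ<q : ∀ t → κ t <ℕ length ts
    κ<q t = subst (κ t <ℕ_) (sym (Pointwise.Pointwise-length ps)) (rank< d ds (colour xs t))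
    copy : KRainbow G κ κ-swap₁₂ κ-swap₂₃ (length ts) κ<q → HasRainbowCopy χ G
    copy (φ , uφ , uc) =
      (λ v → List.lookup xs (Vec.lookup φ v)) ,
      (λ {v} {w} eq → VecUniqueₚ.lookup-injective uφ v w (lookup-injective uxs eq)) ,
      -- Colours of distinct ranks are distinct, so a copy that is rainbow after merging is rainbow
      -- in `χ`.
      AllPairsₚ.map⁺ (AllPairs.map (λ ne eq → ne (cong (rank (d ∷ ds)) eq)) (AllPairsₚ.map⁻ uc))

-- Positions of triples

_∈F?_ : ∀ {n} (x : Fin n) xs → Dec (x ∈ xs)
_∈F?_ = DecMembership._∈?_ _≟F_

Unique⇒length≤ : ∀ {n} {xs : List (Fin n)} → Unique xs → length xs ≤ n
Unique⇒length≤ {xs = xs} u = injective⇒≤ {f = List.lookup xs} (lookup-injective u)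

index-injective : ∀ {A : Set} {xs : List A} {x y} (p : x ∈ xs) (q : y ∈ xs) →
                  Any.index p ≡ Any.index q → x ≡ y
index-injective {xs = xs} p q eq =
  trans (Anyₚ.lookup-index p) (trans (cong (List.lookup xs) eq) (sym (Anyₚ.lookup-index q)))

fresh : ∀ {n} (xs : List (Fin n)) → length xs <ℕ n → ∃ λ x → x ∉ xs
fresh xs l<n with any? (λ x → ¬? (x ∈F? xs))
... | yes p = p
... | no np = contradiction (injective⇒≤ λ {x} {y} → index-injective (found x) (found y)) (<⇒≱ l<n)
  where
  found : ∀ x → x ∈ xs
  found x = decidable-stable (x ∈F? xs) λ x∉ → np (x , x∉)

_∷ᵘ_ : ∀ {A : Set} {x : A} {xs} → x ∉ xs → Unique xs → Unique (x ∷ xs)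
x∉ ∷ᵘ u = Allₚ.¬Any⇒All¬ _ x∉ ∷ u

∉-++ : ∀ {A : Set} {x : A} {xs ys} → x ∉ xs → x ∉ ys → x ∉ xs ++ ys
∉-++ {xs = xs} x∉xs x∉ys p with Anyₚ.++⁻ xs p
... | inj₁ q = x∉xs q
... | inj₂ q = x∉ys q

pattern 1st = here refl
pattern 2nd = there (here refl)
pattern 3rd = there (there (here refl))
pattern 4th = there (there (there (here refl)))

module _ {n : ℕ} where

  vertices : DTriple n → List (Fin n)
  vertices e = t1 e ∷ t2 e ∷ t3 e ∷ []

  triple : ∀ {x y z : Fin n} → Unique (x ∷ y ∷ z ∷ []) → DTriple n
  triple ((x≢y ∷ x≢z ∷ []) ∷ (y≢z ∷ []) ∷ _) = dtriple _ _ _ x≢y x≢z y≢z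

  -- Lets an edge be written with its vertices in whichever order a configuration needs, while
  -- colour and membership carry over.
  record _is_ (e : DTriple n) (t : Triple n) : Set where
    constructor arranged
    vs : List (Fin n)
    vs = proj₁ t ∷ proj₁ (proj₂ t) ∷ proj₂ (proj₂ t) ∷ []
    field
      unique : Unique vs
      value  : ∀ χ → colOf χ e ≡ col χ (proj₁ t) (proj₁ (proj₂ t)) (proj₂ (proj₂ t))
      to     : ∀ {v} → v ∈ vertices e → v ∈ vs
      from   : ∀ {v} → v ∈ vs → v ∈ vertices e
  open _is_ public

  is-itself : ∀ e → e is (t1 e , t2 e , t3 e)
  is-itself e = arranged ((d12 e ∷ d13 e ∷ []) ∷ (d23 e ∷ []) ∷ [] ∷ []) (λ _ → refl) (λ p → p) (λ p → p)

  swap₁₂ : ∀ {e x y z} → e is (x , y , z) → e is (y , x , z)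
  swap₁₂ {e} {x} {y} {z} (arranged ((x≢y ∷ x≢z ∷ []) ∷ (y≢z ∷ []) ∷ _) v t f) =
    arranged ((≢-sym x≢y ∷ y≢z ∷ []) ∷ (x≢z ∷ []) ∷ [] ∷ []) (λ χ → trans (v χ) (swap12 χ _ _ _))
             (flip ∘ t) (f ∘ flip)
    where
    flip : ∀ {a b c v : Fin n} → v ∈ a ∷ b ∷ c ∷ [] → v ∈ b ∷ a ∷ c ∷ []
    flip 1st = 2nd
    flip 2nd = 1st
    flip 3rd = 3rd

  swap₂₃ : ∀ {e x y z} → e is (x , y , z) → e is (x , z , y)
  swap₂₃ {e} {x} {y} {z} (arranged ((x≢y ∷ x≢z ∷ []) ∷ (y≢z ∷ []) ∷ _) v t f) =
    arranged ((x≢z ∷ x≢y ∷ []) ∷ (≢-sym y≢z ∷ []) ∷ [] ∷ []) (λ χ → trans (v χ) (swap23 χ _ _ _))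
             (flip ∘ t) (f ∘ flip)
    where
    flip : ∀ {a b c v : Fin n} → v ∈ a ∷ b ∷ c ∷ [] → v ∈ a ∷ c ∷ b ∷ []
    flip 1st = 1st
    flip 2nd = 3rd
    flip 3rd = 2nd

  leading : ∀ {e x} → x ∈ vertices e → ∃₂ λ y z → e is (x , y , z)
  leading {e} 1st = _ , _ , is-itself e
  leading {e} 2nd = _ , _ , swap₁₂ (is-itself e)
  leading {e} 3rd = _ , _ , swap₁₂ (swap₂₃ (is-itself e))

  leading₂ : ∀ {e x y} → x ∈ vertices e → y ∈ vertices e → x ≢ y → ∃ λ z → e is (x , y , z)
  leading₂ x∈ y∈ x≢y with leading x∈
  ... | _ , _ , i with to i y∈
  ...   | 1st = contradiction refl x≢y
  ...   | 2nd = _ , i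
  ...   | 3rd = _ , swap₂₃ i

  data Split (P : Fin n → Set) (e : DTriple n) : Set where
    none : All (¬_ ∘ P) (vertices e) → Split P e
    one  : ∀ {x y z} → e is (x , y , z) → P x → ¬ P y → ¬ P z → Split P e
    two  : ∀ {x y z} → e is (x , y , z) → P x → P y → ¬ P z → Split P e
    all  : All P (vertices e) → Split P e

  split : ∀ {P} → (∀ x → Dec (P x)) → ∀ e → Split P e
  split P? e with P? (t1 e) | P? (t2 e) | P? (t3 e)
  ... | yes p | yes q | yes r = all (p ∷ q ∷ r ∷ [])
  ... | yes p | yes q | no r  = two (is-itself e) p q r
  ... | yes p | no q  | yes r = two (swap₂₃ (is-itself e)) p r q
  ... | yes p | no q  | no r  = one (is-itself e) p q r
  ... | no p  | yes q | yes r = two (swap₂₃ (swap₁₂ (is-itself e))) q r p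
  ... | no p  | yes q | no r  = one (swap₁₂ (is-itself e)) q p r
  ... | no p  | no q  | yes r = one (swap₁₂ (swap₂₃ (is-itself e))) r p q
  ... | no p  | no q  | no r  = none (p ∷ q ∷ r ∷ [])

  Apart : DTriple n → DTriple n → Set
  Apart e f = Disjoint (vertices e) (vertices f)

  -- Only an upper bound on the intersection; that `x` lies in both triples comes from the
  -- arrangements given alongside.
  Touching : DTriple n → DTriple n → Fin n → Set
  Touching e f x = ∀ {v} → v ∈ vertices e → v ∈ vertices f → v ≡ x

  Close : DTriple n → DTriple n → Set
  Close e f = ∃₂ λ x y → ∃₂ λ u v → e is (x , y , u) × f is (x , y , v) × u ≢ v

  -- The constructors are the intersection sizes three, two, one and zero. For equal vertex sets,
  -- only equality of the colours is kept.
  data Pair (e f : DTriple n) : Set where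
    same     : (∀ χ → colOf χ e ≡ colOf χ f) → Pair e f
    close    : Close e f → Pair e f
    touching : ∀ {x u v w z} → e is (x , u , v) → f is (x , w , z) → Touching e f x → Pair e f
    apart    : Apart e f → Pair e f

  ⊆⇒same : ∀ {e f} → All (_∈ vertices f) (vertices e) → ∀ χ → colOf χ e ≡ colOf χ f
  ⊆⇒same {e} {f} (p ∷ q ∷ r ∷ []) χ with leading₂ {f} p q (d12 e)
  ... | _ , j with to j r
  ...   | 1st = contradiction refl (d13 e)
  ...   | 2nd = contradiction refl (d23 e)
  ...   | 3rd = sym (value j χ)

  disjoint⇒apart : ∀ {e f} → All (_∉ vertices f) (vertices e) → Apart e f
  disjoint⇒apart ns (v∈e , v∈f) = All.lookup ns v∈e v∈f

  pair : ∀ e f → Pair e f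
  pair e f with split (_∈F? vertices f) e
  ... | none ns = apart (disjoint⇒apart {e} {f} ns)
  ... | one i x∈ y∉ z∉ with leading x∈
  ...   | _ , _ , j = touching i j only
    where
    only : Touching e f _
    only v∈e v∈f with to i v∈e
    ... | 1st = refl
    ... | 2nd = contradiction v∈f y∉
    ... | 3rd = contradiction v∈f z∉
  pair e f | two i x∈ y∈ z∉ with unique i
  ... | (x≢y ∷ _) ∷ _ with leading₂ x∈ y∈ x≢y
  ...   | _ , j = close (_ , _ , _ , _ , i , j , λ { refl → z∉ (from j 3rd) })
  pair e f | all ps = same (⊆⇒same {e} {f} ps)

  Apart-sym : ∀ {e f} → Apart e f → Apart f e
  Apart-sym d (p , q) = d (q , p)

  Close-sym : ∀ {e f} → Close e f → Close f e
  Close-sym (x , y , u , v , i , j , u≢v) = x , y , v , u , j , i , ≢-sym u≢v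

  six : ∀ {e f s t} → Apart e f → (i : e is s) (j : f is t) → Unique (vs i ++ vs j)
  six d i j = Uniqueₚ.++⁺ (unique i) (unique j) λ (p , q) → d (from i p , from j q)

  outside : ∀ {e f s t x} (i : e is s) (j : f is t) → x ∉ vertices e → x ∉ vertices f → x ∉ vs i ++ vs j
  outside i j x∉e x∉f = ∉-++ (x∉e ∘ from i) (x∉f ∘ from j)

new-vertex : ∀ {n} {e g : DTriple n} {x y z s} → e is (x , y , z) → g is (x , y , s) → z ≢ s → s ∉ vertices e
new-vertex i k z≢s s∈e with to i s∈e | unique k
... | 1st | (_ ∷ n ∷ _) ∷ _ = n refl
... | 2nd | _ ∷ (n ∷ _) ∷ _ = n refl
... | 3rd | _               = z≢s refl

module _ {n} {xs : List (Fin n)} (u : Unique xs) where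

  private
    distinct? : ∀ is → Dec (Unique is)
    distinct? = DecUnique.unique? (_≟F_ {length xs})

  -- Naming vertices by their positions in a duplicate-free list turns distinctness and disjointness
  -- into computations on positions.
  at : ∀ i j k → {True (distinct? (i ∷ j ∷ k ∷ []))} → DTriple n
  at i j k {d} with toWitness d
  ... | (ij ∷ ik ∷ []) ∷ (jk ∷ []) ∷ _ =
    dtriple (List.lookup xs i) (List.lookup xs j) (List.lookup xs k)
            (ij ∘ lookup-injective u) (ik ∘ lookup-injective u) (jk ∘ lookup-injective u)

  at-is : ∀ i j k {d} → at i j k {d} is (List.lookup xs i , List.lookup xs j , List.lookup xs k)
  at-is i j k {d} with toWitness d
  ... | (ij ∷ ik ∷ []) ∷ (jk ∷ []) ∷ _ = is-itself _

  apart-at : ∀ ((i , j , k) (l , m , o) : Triple (length xs)) {e f} →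
             {True (distinct? (i ∷ j ∷ k ∷ l ∷ m ∷ o ∷ []))} →
             e is (List.lookup xs i , List.lookup xs j , List.lookup xs k) →
             f is (List.lookup xs l , List.lookup xs m , List.lookup xs o) → Apart e f
  apart-at (i , j , k) (l , m , o) {_} {_} {d} p q (v∈e , v∈f) with ∈-map⁻ (List.lookup xs) {xs = i ∷ j ∷ k ∷ []} (to p v∈e)
                                      | ∈-map⁻ (List.lookup xs) {xs = l ∷ m ∷ o ∷ []} (to q v∈f)
  ... | s , s∈ , refl | t , t∈ , eq = absurd (toWitness d) s∈ (subst (_∈ _) (sym (lookup-injective u eq)) t∈)
    where
    absurd : ∀ {s} → Unique ((i ∷ j ∷ k ∷ []) ++ l ∷ m ∷ o ∷ []) → s ∈ i ∷ j ∷ k ∷ [] → s ∉ l ∷ m ∷ o ∷ []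
    absurd (ns ∷ _) 1st p             = All.lookup (All.tail (All.tail ns)) p refl
    absurd (_ ∷ ns ∷ _) 2nd p         = All.lookup (All.tail ns) p refl
    absurd (_ ∷ _ ∷ ns ∷ _) 3rd p     = All.lookup ns p refl

fresh₂ : ∀ {n} {xs : List (Fin n)} → Unique xs → suc (length xs) <ℕ n → ∃₂ λ p q → Unique (p ∷ q ∷ xs)
fresh₂ {xs = xs} u l with fresh xs (<-trans (n<1+n _) l)
... | q , q∉ with fresh (q ∷ xs) l
...   | p , p∉ = p , q , p∉ ∷ᵘ (q∉ ∷ᵘ u)

close-unique : ∀ {n} {e f : DTriple n} {x y u v} → e is (x , y , u) → f is (x , y , v) → u ≢ v →
               Unique (x ∷ y ∷ u ∷ v ∷ [])
close-unique i j u≢v with unique i | unique j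
... | (xy ∷ xu ∷ []) ∷ (yu ∷ []) ∷ _ | (_ ∷ xv ∷ []) ∷ (yv ∷ []) ∷ _ =
  (xy ∷ xu ∷ xv ∷ []) ∷ (yu ∷ yv ∷ []) ∷ (u≢v ∷ []) ∷ [] ∷ []

touch-unique : ∀ {n} {e f : DTriple n} {x u v w z} → e is (x , u , v) → f is (x , w , z) → Touching e f x →
               Unique (x ∷ u ∷ v ∷ w ∷ z ∷ [])
touch-unique i j t with unique i | unique j
... | (xu ∷ xv ∷ []) ∷ (uv ∷ []) ∷ _ | (xw ∷ xz ∷ []) ∷ (wz ∷ []) ∷ _ =
  (xu ∷ xv ∷ xw ∷ xz ∷ []) ∷
  (uv ∷ (λ { refl → xu (sym (t (from i 2nd) (from j 2nd))) }) ∷ (λ { refl → xu (sym (t (from i 2nd) (from j 3rd))) }) ∷ []) ∷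
  ((λ { refl → xv (sym (t (from i 3rd) (from j 2nd))) }) ∷ (λ { refl → xv (sym (t (from i 3rd) (from j 3rd))) }) ∷ []) ∷
  (wz ∷ []) ∷ [] ∷ []

module _ {n : ℕ} where

  data Position (e f g : DTriple n) : Set where
    same₁  : (∀ χ → colOf χ e ≡ colOf χ g) → Position e f g
    same₂  : (∀ χ → colOf χ f ≡ colOf χ g) → Position e f g
    close₁ : Close e g → Position e f g
    close₂ : Close f g → Position e f g
    away   : Apart e g → Apart f g → Position e f g
    touch₁ : ∀ {x u v w z} → e is (x , u , v) → g is (x , w , z) → Touching e g x → Apart f g → Position e f g
    touch₂ : ∀ {x u v w z} → f is (x , u , v) → g is (x , w , z) → Touching f g x → Apart e g → Position e f g
    cross  : ∀ {x y z u v w p} → e is (x , y , z) → f is (u , v , w) → g is (x , u , p) →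
             p ∉ vertices e → p ∉ vertices f → Position e f g

  -- If `g` meets both triples in one vertex, the two vertices differ since `e` and `f` are
  -- disjoint, and the third vertex of `g` lies outside both: this is `cross`.
  position : ∀ {e f} g → Apart e f → Position e f g
  position {e} {f} g d with pair e g | pair f g
  ... | same s  | _       = same₁ s
  ... | close c | _       = close₁ c
  ... | _       | same s  = same₂ s
  ... | _       | close c = close₂ c
  ... | apart a | apart b = away a b
  ... | touching i j t | apart b = touch₁ i j t b
  ... | apart a | touching i j t = touch₂ i j t a
  ... | touching i j t | touching i′ j′ t′
    with leading₂ {e = g} (from j 1st) (from j′ 1st) (λ { refl → d (from i 1st , from i′ 1st) })
  ...   | p , h with unique h
  ...     | (_ ∷ x≢p ∷ []) ∷ (u≢p ∷ []) ∷ _ = cross i i′ h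
    (λ p∈e → x≢p (sym (t p∈e (from h 3rd)))) (λ p∈f → u≢p (sym (t′ p∈f (from h 3rd))))

  -- Each of `g` and `h` contains two of the three vertices of `e`, and two such pairs meet.
  close-common : ∀ {e g h : DTriple n} → Close e g → Close e h → ¬ Apart g h
  close-common (x , y , z , s , i , k , _) (x′ , y′ , z′ , s′ , i′ , k′ , _) d with unique i′
  ... | (x′≢y′ ∷ _) ∷ _ = locate (to i (from i′ 1st)) (to i (from i′ 2nd)) x′≢y′
    where
    locate : x′ ∈ x ∷ y ∷ z ∷ [] → y′ ∈ x ∷ y ∷ z ∷ [] → x′ ≢ y′ → ⊥
    locate 1st _ _ = d (from k 1st , from k′ 1st)
    locate 2nd _ _ = d (from k 2nd , from k′ 1st)
    locate 3rd 1st _ = d (from k 1st , from k′ 2nd)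
    locate 3rd 2nd _ = d (from k 2nd , from k′ 2nd)
    locate 3rd 3rd p = p refl

-- Comparing colours, and decidability of rainbow copies

one-of : ∀ (a b c : ℕ) → (c ≡ a ⊎ c ≡ b) ⊎ (c ≢ a × c ≢ b)
one-of a b c with c ≟ℕ a | c ≟ℕ b
... | yes p | _     = inj₁ (inj₁ p)
... | no _  | yes q = inj₁ (inj₂ q)
... | no p  | no q  = inj₂ (p , q)

distinct₃ : ∀ {a b c : ℕ} → a ≢ b → c ≢ a → c ≢ b → Unique (a ∷ b ∷ c ∷ [])
distinct₃ p q r = (p ∷ ≢-sym q ∷ []) ∷ (≢-sym r ∷ []) ∷ [] ∷ []

rotate₃ : ∀ {a b c : ℕ} → Unique (a ∷ b ∷ c ∷ []) → Unique (b ∷ a ∷ c ∷ [])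
rotate₃ ((ab ∷ ac ∷ []) ∷ (bc ∷ []) ∷ _) = distinct₃ (≢-sym ab) (≢-sym bc) (≢-sym ac)

cong₃ : ∀ {A B : Set} (f : A → A → A → B) {i i′ j j′ k k′} → i ≡ i′ → j ≡ j′ → k ≡ k′ → f i j k ≡ f i′ j′ k′
cong₃ f refl refl refl = refl

any-vec? : ∀ {n m} {P : Vec (Fin n) m → Set} → (∀ φ → Dec (P φ)) → Dec (∃ P)
any-vec? {m = zero}  P? = map′ (λ p → [] , p) (λ { ([] , p) → p }) (P? [])
any-vec? {m = suc m} P? = map′ (λ { (x , φ , p) → x ∷ φ , p }) (λ { (x ∷ φ , p) → x , φ , p })
                               (any? λ x → any-vec? λ φ → P? (x ∷ φ))

hasRainbowCopy? : ∀ {n} (χ : Colouring n) G → Dec (HasRainbowCopy χ G)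
hasRainbowCopy? χ G =
  map′ (λ { (φ , inj , u) → Vec.lookup φ , (λ {v} {w} → inj v w) , u })
       (λ { (φ , inj , u) → Vec.tabulate φ ,
            (λ v w eq → inj (trans (sym (lookup∘tabulate φ v)) (trans eq (lookup∘tabulate φ w)))) ,
            subst Unique (map-cong (λ { (a , b , c) → cong₃ (col χ) (sym (lookup∘tabulate φ a)) (sym (lookup∘tabulate φ b))
                                                               (sym (lookup∘tabulate φ c)) }) (edges G)) u })
       (any-vec? λ φ →
         (all? λ v → all? λ w → (Vec.lookup φ v ≟F Vec.lookup φ w) →-dec (v ≟F w)) ×-dec
         DecUnique.unique? _≟ℕ_ (map _ (edges G)))

-- There are finitely many candidate copies, so an upper bound may be proved by contradiction from a
-- rainbow-free colouring.
forces : ∀ {n G k} → (∀ χ → UsesAtLeast χ k → ¬ ¬ HasRainbowCopy χ G) → Forces n G k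
forces {G = G} h χ uses = decidable-stable (hasRainbowCopy? χ G) (h χ uses)

-- Tight paths

-- Reduces the finite check on five vertices to increasing triples.
by-sorting : ∀ {m} (P : Fin m → Fin m → Fin m → Set) →
             (∀ {i j k} → P i j k → P j i k) → (∀ {i j k} → P i j k → P i k j) →
             (∀ i j k → i < j → j < k → P i j k) →
             ∀ i j k → i ≢ j → i ≢ k → j ≢ k → P i j k
by-sorting P flip₁₂ flip₂₃ sorted i j k i≢j i≢k j≢k with <-cmp i j | <-cmp i k | <-cmp j k
... | tri≈ _ e _ | _          | _          = contradiction e i≢j
... | _          | tri≈ _ e _ | _          = contradiction e i≢k
... | _          | _          | tri≈ _ e _ = contradiction e j≢k
... | tri< a _ _ | _          | tri< c _ _ = sorted i j k a c
... | tri< _ _ _ | tri< b _ _ | tri> _ _ c = flip₂₃ (sorted i k j b c)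
... | tri< a _ _ | tri> _ _ b | tri> _ _ c = flip₂₃ (flip₁₂ (sorted k i j b a))
... | tri> _ _ a | tri< b _ _ | _          = flip₁₂ (sorted j i k a b)
... | tri> _ _ a | tri> _ _ b | tri< c _ _ = flip₁₂ (flip₂₃ (sorted j k i c b))
... | tri> _ _ a | tri> _ _ b | tri> _ _ c = flip₁₂ (flip₂₃ (flip₁₂ (sorted k j i c a)))

-- Positions 0 to 3 are the corners `x`, `y`, `u`, `v` of a kite and position 4 is a fifth vertex;
-- `t` is a triple of a supposed third colour.
five-edges : Triple 5 → List (Triple 5)
five-edges t = (# 0 , # 1 , # 2) ∷ (# 0 , # 1 , # 3) ∷ t ∷ []

five-splits : List (Triple 5)
five-splits = (# 0 , # 1 , # 4) ∷ (# 0 , # 2 , # 3) ∷ (# 1 , # 2 , # 4) ∷ []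

-- Evaluation over the ten increasing triples shows that five vertices around a kite carry only its
-- two colours.
five-refutes : ∀ i j k → i < j → j < k → Refutes tightPath (five-edges (i , j , k)) five-splits
five-refutes i j k i<j j<k = certified (toWitness {a? = decide} tt i j k i<j j<k)
  where
  decide : Dec (∀ i j k → i < j → j < k →
                T (refute tightPath 3 five-splits (concatMap orders (ranks (five-edges (i , j , k))))))
  decide = all? λ i → all? λ j → all? λ k → (i <? j) →-dec ((j <? k) →-dec
             T? (refute tightPath 3 five-splits (concatMap orders (ranks (five-edges (i , j , k))))))

module Tight {n} (χ : Colouring n) (5≤n : 5 ≤ n) (free : ¬ HasRainbowCopy χ tightPath) where

  record Kite (a b : ℕ) (x y u v : Fin n) : Set where
    constructor kite
    field
      distinct : Unique (x ∷ y ∷ u ∷ v ∷ [])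
      ⟨xyu⟩    : col χ x y u ≡ a
      ⟨xyv⟩    : col χ x y v ≡ b
  open Kite public

  module _ {a b x y u v} (q : Kite a b x y u v) (a≢b : a ≢ b) where

    corners : List (Fin n)
    corners = x ∷ y ∷ u ∷ v ∷ []

    five : ∀ {w} → w ∉ corners → ∀ {g i j k} → g is (i , j , k) →
           let xs = corners ++ w ∷ [] in i ∈ xs → j ∈ xs → k ∈ xs →
           colOf χ g ≡ a ⊎ colOf χ g ≡ b
    five {w} w∉ {g} {i} {j} {k} h i∈ j∈ k∈ = subst Known eq
      (by-sorting (λ i j k → Known (colour χ xs (i , j , k))) (subst Known (swap12 χ _ _ _)) (subst Known (swap23 χ _ _ _))
        sorted (Any.index i∈) (Any.index j∈) (Any.index k∈) (differ i∈ j∈ i≢j) (differ i∈ k∈ i≢k) (differ j∈ k∈ j≢k))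
      where
      xs = corners ++ w ∷ []
      Known : ℕ → Set
      Known c = c ≡ a ⊎ c ≡ b
      uxs : Unique xs
      uxs with distinct q
      ... | (xy ∷ xu ∷ xv ∷ []) ∷ (yu ∷ yv ∷ []) ∷ (uv ∷ []) ∷ _ =
        (xy ∷ xu ∷ xv ∷ (λ { refl → w∉ 1st }) ∷ []) ∷ (yu ∷ yv ∷ (λ { refl → w∉ 2nd }) ∷ []) ∷
        (uv ∷ (λ { refl → w∉ 3rd }) ∷ []) ∷ ((λ { refl → w∉ 4th }) ∷ []) ∷ [] ∷ []
      sorted : ∀ i j k → i < j → j < k → Known (colour χ xs (i , j , k))
      sorted i j k i<j j<k with one-of a b (colour χ xs (i , j , k))
      ... | inj₁ p = p
      ... | inj₂ (p , q′) = ⊥-elim (refuted χ free uxs (distinct₃ a≢b p q′) (five-edges (i , j , k)) five-splits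
                            (⟨xyu⟩ q ∷ ⟨xyv⟩ q ∷ refl ∷ []) (five-refutes i j k i<j j<k))
      differ : ∀ {v w} (p : v ∈ xs) (q : w ∈ xs) → v ≢ w → Any.index p ≢ Any.index q
      differ p q v≢w e = v≢w (index-injective p q e)
      i≢j : i ≢ j
      i≢j with unique h
      ... | (p ∷ _) ∷ _ = p
      i≢k : i ≢ k
      i≢k with unique h
      ... | (_ ∷ p ∷ _) ∷ _ = p
      j≢k : j ≢ k
      j≢k with unique h
      ... | _ ∷ (p ∷ _) ∷ _ = p
      eq : colour χ xs (Any.index i∈ , Any.index j∈ , Any.index k∈) ≡ colOf χ g
      eq = trans (cong₃ (col χ) (sym (Anyₚ.lookup-index i∈)) (sym (Anyₚ.lookup-index j∈)) (sym (Anyₚ.lookup-index k∈)))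
                 (sym (value h χ))

    -- The third vertex of `g` together with the corners gives the five vertices for `five`. If it
    -- is a corner itself, `5 ≤ n` supplies a fifth vertex.
    two-corners : ∀ {g i j} → i ∈ vertices g → j ∈ vertices g → i ≢ j →
                  i ∈ corners → j ∈ corners → colOf χ g ≡ a ⊎ colOf χ g ≡ b
    two-corners {g} i∈g j∈g i≢j i∈ j∈ with leading₂ {e = g} i∈g j∈g i≢j
    ... | k , h with k ∈F? corners
    ...   | no k∉ = five k∉ h (widen i∈) (widen j∈) (there (there (there 2nd)))
      where
      widen : ∀ {z k} → z ∈ corners → z ∈ corners ++ k ∷ []
      widen = Anyₚ.++⁺ˡ
    ...   | yes k∈ with fresh corners 5≤n
    ...     | w , w∉ = five w∉ h (Anyₚ.++⁺ˡ i∈) (Anyₚ.++⁺ˡ j∈) (Anyₚ.++⁺ˡ k∈)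

  flipped : ∀ {a b x y u v} → Kite a b x y u v → Kite a b y x u v
  flipped (kite ((xy ∷ xu ∷ xv ∷ []) ∷ (yu ∷ yv ∷ []) ∷ r) p q) =
    kite ((≢-sym xy ∷ yu ∷ yv ∷ []) ∷ (xu ∷ xv ∷ []) ∷ r) (trans (swap12 χ _ _ _) p) (trans (swap12 χ _ _ _) q)

  module _ {a b x y u v} (q : Kite a b x y u v) (a≢b : a ≢ b) where

    -- Positions: r, s, x, y, u, v. The tight paths r s x y u and r s x y v force the colour c on
    -- xys. Then no colour is left for xus: b is refuted by r s x u y, a by u s x y v, and c by s u
    -- x y v.
    no-pendant : ∀ {c} → c ≢ a → c ≢ b → ∀ {r s} → r ∉ corners q a≢b → s ∉ corners q a≢b → r ≢ s →
                 col χ x r s ≢ c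
    no-pendant c≢a c≢b {r} {s} r∉ s∉ r≢s eq =
      refuted χ free ((λ { 1st → r≢s refl ; (there p) → r∉ p }) ∷ᵘ (s∉ ∷ᵘ distinct q)) (distinct₃ a≢b c≢a c≢b)
        ((# 2 , # 3 , # 4) ∷ (# 2 , # 3 , # 5) ∷ (# 2 , # 0 , # 1) ∷ [])
        ((# 2 , # 3 , # 1) ∷ (# 2 , # 4 , # 1) ∷ [])
        (⟨xyu⟩ q ∷ ⟨xyv⟩ q ∷ eq ∷ []) (certified _)

    module _ {g} (g≢a : colOf χ g ≢ a) (g≢b : colOf χ g ≢ b) where

      one-corner : ∀ {i j} → i ∈ vertices g → j ∈ vertices g → i ∈ corners q a≢b → j ∈ corners q a≢b → i ≡ j
      one-corner {i} {j} i∈g j∈g i∈ j∈ with i ≟F j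
      ... | yes p = p
      ... | no i≢j with two-corners q a≢b {g} i∈g j∈g i≢j i∈ j∈
      ...   | inj₁ p = contradiction p g≢a
      ...   | inj₂ p = contradiction p g≢b

      x∉ : x ∉ vertices g
      x∉ x∈ with leading {e = g} x∈
      ... | r , s , h with unique h
      ...   | (x≢r ∷ x≢s ∷ []) ∷ (r≢s ∷ []) ∷ _ =
        no-pendant g≢a g≢b (λ r∈ → x≢r (one-corner x∈ (from h 2nd) 1st r∈))
          (λ s∈ → x≢s (one-corner x∈ (from h 3rd) 1st s∈)) r≢s (sym (value h χ))

  y∉ : ∀ {a b x y u v} → Kite a b x y u v → a ≢ b → ∀ {g} → colOf χ g ≢ a → colOf χ g ≢ b → y ∉ vertices g
  y∉ q a≢b {g} = x∉ (flipped q) a≢b {g}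

  Meet : DTriple n → DTriple n → Set
  Meet e f = ∃ λ v → v ∈ vertices e × v ∈ vertices f

  -- The colour of xuw decides. A third colour makes v u x w z rainbow, the colour of `f` gives a
  -- kite on xu, and that of `e` a kite on xw.
  touch-kite : ∀ {e f x u v w z} → e is (x , u , v) → f is (x , w , z) → Touching e f x →
               colOf χ e ≢ colOf χ f →
               Kite (colOf χ e) (colOf χ f) x u v w ⊎ Kite (colOf χ e) (colOf χ f) x w u z
  touch-kite {e} {f} {x} {u} {v} {w} {z} i j t a≢b = from-five (touch-unique {e = e} {f} i j t) (one-of _ _ (col χ x u w))
    where
    from-five : Unique (x ∷ u ∷ v ∷ w ∷ z ∷ []) →
                (col χ x u w ≡ colOf χ e ⊎ col χ x u w ≡ colOf χ f) ⊎
                (col χ x u w ≢ colOf χ e × col χ x u w ≢ colOf χ f) →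
                Kite (colOf χ e) (colOf χ f) x u v w ⊎ Kite (colOf χ e) (colOf χ f) x w u z
    from-five ((xu ∷ xv ∷ xw ∷ xz ∷ []) ∷ (uv ∷ uw ∷ uz ∷ []) ∷ (vw ∷ vz ∷ []) ∷ (wz ∷ []) ∷ _) (inj₁ (inj₂ p)) =
      inj₁ (kite ((xu ∷ xv ∷ xw ∷ []) ∷ (uv ∷ uw ∷ []) ∷ (vw ∷ []) ∷ [] ∷ []) (sym (value i χ)) p)
    from-five ((xu ∷ xv ∷ xw ∷ xz ∷ []) ∷ (uv ∷ uw ∷ uz ∷ []) ∷ (vw ∷ vz ∷ []) ∷ (wz ∷ []) ∷ _) (inj₁ (inj₁ p)) =
      inj₂ (kite ((xw ∷ xu ∷ xz ∷ []) ∷ (≢-sym uw ∷ wz ∷ []) ∷ (uz ∷ []) ∷ [] ∷ [])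
                 (trans (swap23 χ _ _ _) p) (sym (value j χ)))
    from-five distinct₅ (inj₂ (p , q)) = ⊥-elim (refuted χ free distinct₅ (distinct₃ a≢b p q)
      ((# 0 , # 1 , # 2) ∷ (# 0 , # 3 , # 4) ∷ (# 0 , # 1 , # 3) ∷ []) []
      (sym (value i χ) ∷ sym (value j χ) ∷ refl ∷ []) (certified _))

  close-kite : ∀ {e f x y u v} → e is (x , y , u) → f is (x , y , v) → u ≢ v →
               Kite (colOf χ e) (colOf χ f) x y u v
  close-kite {e} {f} i j u≢v = kite (close-unique {e = e} {f} i j u≢v) (sym (value i χ)) (sym (value j χ))

  meet-kite : ∀ {e f} → Meet e f → colOf χ e ≢ colOf χ f →
              ∃₂ λ x y → ∃₂ λ u v → Kite (colOf χ e) (colOf χ f) x y u v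
  meet-kite {e} {f} (v , v∈e , v∈f) a≢b with pair e f
  ... | same s           = contradiction (s χ) a≢b
  ... | apart d          = ⊥-elim (d (v∈e , v∈f))
  ... | close (_ , _ , _ , _ , i , j , u≢v) = _ , _ , _ , _ , close-kite i j u≢v
  ... | touching i j t with touch-kite i j t a≢b
  ...   | inj₁ q = _ , _ , _ , _ , q
  ...   | inj₂ q = _ , _ , _ , _ , q

  -- The kite of `e` and `f` has at most one corner in `g`, and never `x` or `y`. Once `s` and `t`
  -- are corners they coincide, in a common vertex of `e` and `f`, which `g` was shown to avoid.
  no-triangle : ∀ {e f g} → Meet e f → Meet e g → Meet f g →
                colOf χ e ≢ colOf χ f → colOf χ g ≢ colOf χ e → colOf χ g ≢ colOf χ f → ⊥
  no-triangle {e} {f} {g} (r , r∈e , r∈f) (s , s∈e , s∈g) (t , t∈f , t∈g) a≢b c≢a c≢b with pair e f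
  ... | same p  = a≢b (p χ)
  ... | apart d = d (r∈e , r∈f)
  ... | close (x , y , u , v , i , j , u≢v) = absurd (to i s∈e) (to j s∈f)
    where
    q = close-kite i j u≢v
    t∈Q : t ∈ x ∷ y ∷ v ∷ [] → t ∈ corners q a≢b
    t∈Q 1st = 1st
    t∈Q 2nd = 2nd
    t∈Q 3rd = 4th
    s∈f : s ∈ vertices f
    s∈f = subst (_∈ vertices f) (sym (one-corner q a≢b {g} c≢a c≢b s∈g t∈g (Anyₚ.++⁺ˡ (to i s∈e)) (t∈Q (to j t∈f)))) t∈f
    absurd : s ∈ x ∷ y ∷ u ∷ [] → s ∈ x ∷ y ∷ v ∷ [] → ⊥
    absurd 1st _ = x∉ q a≢b {g} c≢a c≢b s∈g
    absurd 2nd _ = y∉ q a≢b {g} c≢a c≢b s∈g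
    absurd 3rd 1st with unique i
    ... | (_ ∷ n ∷ _) ∷ _ = n refl
    absurd 3rd 2nd with unique i
    ... | _ ∷ (n ∷ _) ∷ _ = n refl
    absurd 3rd 3rd = u≢v refl
  ... | touching {x} i j only with x ∈F? vertices g
  ...   | yes x∈g with touch-kite i j only a≢b
  ...     | inj₁ q = x∉ q a≢b {g} c≢a c≢b x∈g
  ...     | inj₂ q = x∉ q a≢b {g} c≢a c≢b x∈g
  -- Arranging `e` and `f` to begin with x, s and x, t makes `s` and `t` corners of whichever kite
  -- `touch-kite` returns.
  no-triangle {e} {f} {g} _ (s , s∈e , s∈g) (t , t∈f , t∈g) a≢b c≢a c≢b | touching {x} i j only | no x∉g
    with leading₂ {e = e} (from i 1st) s∈e (λ { refl → x∉g s∈g }) | leading₂ {e = f} (from j 1st) t∈f (λ { refl → x∉g t∈g })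
  ... | _ , i′ | _ , j′ with touch-kite i′ j′ only a≢b
  ...   | inj₁ q = absurd (one-corner q a≢b {g} c≢a c≢b s∈g t∈g 2nd 4th)
    where
    absurd : s ≢ t
    absurd refl = x∉g (subst (_∈ vertices g) (only s∈e t∈f) s∈g)
  ...   | inj₂ q = absurd (one-corner q a≢b {g} c≢a c≢b s∈g t∈g 3rd 2nd)
    where
    absurd : s ≢ t
    absurd refl = x∉g (subst (_∈ vertices g) (only s∈e t∈f) s∈g)

  -- The edge `side` of the kite `R` has at most one corner of `Q`, hence two vertices r, s outside
  -- `Q`. Since r, s are corners of `R`, xrs has the colour of `g` or of `h`, and either one
  -- contradicts `no-pendant` for `Q`.
  no-matching : ∀ {e f g h} → Meet e f → Meet g h →
                colOf χ e ≢ colOf χ f → colOf χ g ≢ colOf χ h →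
                colOf χ g ≢ colOf χ e → colOf χ g ≢ colOf χ f → colOf χ h ≢ colOf χ e → colOf χ h ≢ colOf χ f → ⊥
  no-matching {e} {f} {g} {h} ef gh a≢b c≢d c≢a c≢b d≢a d≢b with meet-kite {e} {f} ef a≢b | meet-kite {g} {h} gh c≢d
  ... | x , y , u , v , Q | x′ , y′ , u′ , v′ , R = pick (split (_∈F? corners Q a≢b) side)
    where
    side-unique : Unique (x′ ∷ y′ ∷ u′ ∷ [])
    side-unique with distinct R
    ... | (xy ∷ xu ∷ _) ∷ (yu ∷ _) ∷ _ = (xy ∷ xu ∷ []) ∷ (yu ∷ []) ∷ [] ∷ []
    side : DTriple n
    side = triple side-unique
    side-is : side is (x′ , y′ , u′)
    side-is with side-unique
    ... | (_ ∷ _ ∷ []) ∷ (_ ∷ []) ∷ _ = is-itself _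
    side-colour : colOf χ side ≡ colOf χ g
    side-colour = trans (value side-is χ) (⟨xyu⟩ R)
    s≢a : colOf χ side ≢ colOf χ e
    s≢a p = c≢a (trans (sym side-colour) p)
    s≢b : colOf χ side ≢ colOf χ f
    s≢b p = c≢b (trans (sym side-colour) p)
    in-R : ∀ {s} → s ∈ vertices side → s ∈ corners R c≢d
    in-R p = Anyₚ.++⁺ˡ (to side-is p)
    blocked : ∀ {r s} → r ∈ vertices side → s ∈ vertices side → r ≢ s →
              r ∉ corners Q a≢b → s ∉ corners Q a≢b → ⊥
    blocked {r} {s} r∈ s∈ r≢s r∉ s∉
      with two-corners R c≢d {dtriple x r s (λ { refl → r∉ 1st }) (λ { refl → s∉ 1st }) r≢s} 2nd 3rd r≢s (in-R r∈) (in-R s∈)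
    ... | inj₁ p = no-pendant Q a≢b c≢a c≢b r∉ s∉ r≢s p
    ... | inj₂ p = no-pendant Q a≢b d≢a d≢b r∉ s∉ r≢s p
    pick : Split (_∈ corners Q a≢b) side → ⊥
    pick (none (x∉ ∷ y∉ ∷ _)) = blocked 1st 2nd (d12 side) x∉ y∉
    pick (one i _ r∉ s∉) with unique i
    ... | _ ∷ (r≢s ∷ _) ∷ _ = blocked (from i 2nd) (from i 3rd) r≢s r∉ s∉
    pick (two i r∈ s∈ _) with unique i
    ... | (r≢s ∷ _) ∷ _ = r≢s (one-corner Q a≢b {side} s≢a s≢b (from i 1st) (from i 2nd) r∈ s∈)
    pick (all (r∈ ∷ s∈ ∷ _)) = d12 side (one-corner Q a≢b {side} s≢a s≢b 1st 2nd r∈ s∈)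

-- Pigeonhole on the `k * 3` vertex slots; two slots of the same triple never hold the same vertex.
crowded : ∀ {n k} (g : Fin k → DTriple n) → n <ℕ k * 3 →
          ∃₂ λ i j → i ≢ j × ∃ λ v → v ∈ vertices (g i) × v ∈ vertices (g j)
crowded {n} {k} g n<3k with pigeonhole n<3k (vertex ∘ remQuot 3)
  where
  vertex : Fin k × Fin 3 → Fin n
  vertex (i , p) = List.lookup (vertices (g i)) p
... | s , t , s<t , eq = common (remQuot 3 s) (remQuot 3 t) (<⇒≢ s<t ∘ remQuot-injective) eq
  where
  remQuot-injective : remQuot {k} 3 s ≡ remQuot {k} 3 t → s ≡ t
  remQuot-injective e = trans (sym (combine-remQuot {k} 3 s))
    (trans (cong (λ r → combine (proj₁ r) (proj₂ r)) e) (combine-remQuot {k} 3 t))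
  common : (x y : Fin k × Fin 3) → x ≢ y →
           List.lookup (vertices (g (proj₁ x))) (proj₂ x) ≡ List.lookup (vertices (g (proj₁ y))) (proj₂ y) →
           ∃₂ λ i j → i ≢ j × ∃ λ v → v ∈ vertices (g i) × v ∈ vertices (g j)
  common (i , p) (j , q) x≢y e =
    i , j , (λ { refl → x≢y (cong (i ,_) (lookup-injective (unique (is-itself (g i))) e)) }) ,
    _ , ∈-lookup p , subst (_∈ vertices (g j)) (sym e) (∈-lookup q)

-- Deleting any one of the k + 1 representatives leaves k triples, too many to be disjoint. So the
-- intersection graph has an edge avoiding any given vertex, and without disjoint edges this
-- produces a triangle.
tight-upper : ∀ {n k} → 5 ≤ n → n <ℕ k * 3 → Forces n tightPath (suc k)
tight-upper {n} {k} 5≤n n<3k = forces λ χ (f , inj) free → contradict χ f inj free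
  where
  module _ (χ : Colouring n) (f : Fin (suc k) → DTriple n)
           (inj : ∀ i j → colOf χ (f i) ≡ colOf χ (f j) → i ≡ j) (free : ¬ HasRainbowCopy χ tightPath) where
    open Tight χ 5≤n free

    Edge : Fin (suc k) → Fin (suc k) → Set
    Edge i j = i ≢ j × Meet (f i) (f j)

    Edge-sym : ∀ {i j} → Edge i j → Edge j i
    Edge-sym (i≢j , v , p , q) = ≢-sym i≢j , v , q , p

    avoiding : ∀ r → ∃₂ λ i j → i ≢ r × j ≢ r × Edge i j
    avoiding r with crowded (f ∘ punchIn r) n<3k
    ... | i , j , i≢j , m = punchIn r i , punchIn r j , punchInᵢ≢i r i , punchInᵢ≢i r j ,
                            (λ e → i≢j (punchIn-injective r i j e)) , m

    differ : ∀ {i j} → i ≢ j → colOf χ (f i) ≢ colOf χ (f j)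
    differ i≢j e = i≢j (inj _ _ e)

    linked : ∀ {i j k l} → Edge i j → Edge k l → k ≢ i → l ≢ i → k ≡ j ⊎ l ≡ j
    linked {i} {j} {k} {l} (i≢j , ij) (k≢l , kl) k≢i l≢i with k ≟F j | l ≟F j
    ... | yes p | _     = inj₁ p
    ... | no _  | yes p = inj₂ p
    ... | no k≢j | no l≢j = ⊥-elim (no-matching {f i} {f j} {f k} {f l} ij kl (differ i≢j) (differ k≢l)
                              (differ k≢i) (differ k≢j) (differ l≢i) (differ l≢j))

    path : ∃₂ λ i j → ∃ λ l → Edge i j × Edge j l × l ≢ i
    -- Avoiding `zero` merely yields some edge ij; an edge avoiding `i` must then pass through `j`.
    path with avoiding zero
    ... | i , j , _ , _ , ij with avoiding i
    ...   | r , s , r≢i , s≢i , rs with linked ij rs r≢i s≢i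
    ...     | inj₁ refl = i , j , s , ij , rs , s≢i
    ...     | inj₂ refl = i , j , r , ij , Edge-sym rs , r≢i

    contradict : ⊥
    contradict with path
    ... | i , j , l , ij , jl , l≢i with avoiding j
    -- An edge avoiding `j` must meet ij in `i` and jl in `l`, so it closes the triangle.
    ...   | r , s , r≢j , s≢j , rs = third (linked (Edge-sym ij) rs r≢j s≢j) (linked jl rs r≢j s≢j)
      where
      triangle : Edge i l → ⊥
      triangle (_ , il) = no-triangle {f i} {f j} {f l} (proj₂ ij) il (proj₂ jl)
        (differ (proj₁ ij)) (differ l≢i) (differ (≢-sym (proj₁ jl)))
      third : r ≡ i ⊎ s ≡ i → r ≡ l ⊎ s ≡ l → ⊥
      third (inj₁ refl) (inj₁ refl) = l≢i refl
      third (inj₁ refl) (inj₂ refl) = triangle rs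
      third (inj₂ refl) (inj₁ refl) = triangle (Edge-sym rs)
      third (inj₂ refl) (inj₂ refl) = l≢i refl

-- Messy paths

third-of : ∀ {k} (c : Fin (suc (suc (suc k))) → ℕ) → (∀ i j → c i ≡ c j → i ≡ j) →
           ∀ a b → ∃ λ i → c i ≢ a × c i ≢ b
third-of c inj a b = pick (classify zero) (classify (suc zero)) (classify (suc (suc zero)))
  where
  classify : ∀ i → (c i ≡ a ⊎ c i ≡ b) ⊎ (c i ≢ a × c i ≢ b)
  classify i = one-of a b (c i)
  clash : ∀ {i j d} {A : Set} → i ≢ j → c i ≡ d → c j ≡ d → A
  clash i≢j p q = contradiction (inj _ _ (trans p (sym q))) i≢j
  pick : (c zero ≡ a ⊎ c zero ≡ b) ⊎ (c zero ≢ a × c zero ≢ b) →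
         (c (suc zero) ≡ a ⊎ c (suc zero) ≡ b) ⊎ (c (suc zero) ≢ a × c (suc zero) ≢ b) →
         (c (suc (suc zero)) ≡ a ⊎ c (suc (suc zero)) ≡ b) ⊎ (c (suc (suc zero)) ≢ a × c (suc (suc zero)) ≢ b) →
         ∃ λ i → c i ≢ a × c i ≢ b
  pick (inj₂ p) _ _ = _ , p
  pick _ (inj₂ p) _ = _ , p
  pick _ _ (inj₂ p) = _ , p
  pick (inj₁ (inj₁ p)) (inj₁ (inj₁ q)) _ = clash (λ ()) p q
  pick (inj₁ (inj₂ p)) (inj₁ (inj₂ q)) _ = clash (λ ()) p q
  pick (inj₁ (inj₁ p)) _ (inj₁ (inj₁ q)) = clash (λ ()) p q
  pick (inj₁ (inj₂ p)) _ (inj₁ (inj₂ q)) = clash (λ ()) p q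
  pick _ (inj₁ (inj₁ p)) (inj₁ (inj₁ q)) = clash (λ ()) p q
  pick _ (inj₁ (inj₂ p)) (inj₁ (inj₂ q)) = clash (λ ()) p q

module Messy {n} (χ : Colouring n) (free : ¬ HasRainbowCopy χ messyPath) where

  module _ {e f g : DTriple n} (d : Apart e f) (distinct : Unique (colOf χ e ∷ colOf χ f ∷ colOf χ g ∷ [])) where

    -- Write e = xyz and g = xyw. If w lies in `f`, the messy path z x y w continued along `f` is
    -- rainbow. Otherwise xy with a vertex of `f` is forced to the colour of `f`, and then z with
    -- two vertices of `f` has no colour left.
    not-close : ¬ Close e g
    not-close (_ , _ , _ , w , i , j , z≢w) with w ∈F? vertices f
    ... | yes w∈ with leading {e = f} w∈
    ...   | _ , _ , k = refuted χ free (six d i k) distinct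
      ((# 0 , # 1 , # 2) ∷ (# 3 , # 4 , # 5) ∷ (# 0 , # 1 , # 3) ∷ []) []
      (sym (value i χ) ∷ sym (value k χ) ∷ sym (value j χ) ∷ []) (certified _)
    not-close (_ , _ , _ , w , i , j , z≢w) | no w∉ =
      refuted χ free (outside i (is-itself f) (new-vertex i j z≢w) w∉ ∷ᵘ six d i (is-itself f)) distinct
        ((# 1 , # 2 , # 3) ∷ (# 4 , # 5 , # 6) ∷ (# 1 , # 2 , # 0) ∷ [])
        ((# 1 , # 2 , # 4) ∷ (# 3 , # 4 , # 5) ∷ [])
        (sym (value i χ) ∷ refl ∷ sym (value j χ) ∷ []) (certified _)

    not-touching : ∀ {x u v w z} → e is (x , u , v) → g is (x , w , z) → Touching e g x → ¬ Apart f g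
    not-touching {w = w} {z} i j t a with unique j
    ... | (x≢w ∷ x≢z ∷ []) ∷ (w≢z ∷ []) ∷ _ =
      -- Positions: w, z, x, u, v, then the three vertices of `f`.
      refuted χ free ((λ { 1st → w≢z refl ; (there p) → out x≢w (from j 2nd) p }) ∷ᵘ
                      (out x≢z (from j 3rd) ∷ᵘ six d i (is-itself f))) distinct
        ((# 2 , # 3 , # 4) ∷ (# 5 , # 6 , # 7) ∷ (# 2 , # 0 , # 1) ∷ [])
        ((# 3 , # 4 , # 6) ∷ (# 2 , # 4 , # 1) ∷ (# 2 , # 5 , # 1) ∷ (# 4 , # 5 , # 6) ∷ [])
        (sym (value i χ) ∷ refl ∷ sym (value j χ) ∷ []) (certified _)
      where
      out : ∀ {s} → _ ≢ s → s ∈ vertices g → s ∉ _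
      out x≢s s∈g = outside i (is-itself f) (λ s∈e → x≢s (sym (t s∈e s∈g))) (λ s∈f → a (s∈f , s∈g))

    not-away : Apart e g → ¬ Apart f g
    not-away a b = refuted χ free (Uniqueₚ.++⁺ (six d (is-itself e) (is-itself f)) (unique (is-itself g))
                                   λ (p , q) → [ (λ p → a (p , q)) , (λ p → b (p , q)) ]′ (Anyₚ.++⁻ (vertices e) p)) distinct
      ((# 0 , # 1 , # 2) ∷ (# 3 , # 4 , # 5) ∷ (# 6 , # 7 , # 8) ∷ [])
      ((# 0 , # 1 , # 5) ∷ (# 0 , # 1 , # 6) ∷ (# 5 , # 6 , # 8) ∷ (# 0 , # 3 , # 4) ∷ (# 0 , # 3 , # 6) ∷ (# 3 , # 5 , # 8) ∷ [])
      (refl ∷ refl ∷ refl ∷ []) (certified _)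

    not-cross : ∀ {x y z u v w p} → e is (x , y , z) → f is (u , v , w) → g is (x , u , p) →
                p ∉ vertices e → p ∉ vertices f → ⊥
    -- Positions: p, x, y, z, u, v, w.
    not-cross i j k p∉e p∉f = refuted χ free (outside i j p∉e p∉f ∷ᵘ six d i j) distinct
      ((# 1 , # 2 , # 3) ∷ (# 4 , # 5 , # 6) ∷ (# 1 , # 4 , # 0) ∷ [])
      ((# 2 , # 3 , # 6) ∷ (# 1 , # 4 , # 6) ∷ (# 3 , # 5 , # 6) ∷ [])
      (sym (value i χ) ∷ sym (value j χ) ∷ sym (value k χ) ∷ []) (certified _)

  no-third-colour : ∀ {e f g} → Apart e f → Unique (colOf χ e ∷ colOf χ f ∷ colOf χ g ∷ []) → ⊥
  no-third-colour {e} {f} {g} d distinct@((_ ∷ ac ∷ []) ∷ (bc ∷ []) ∷ _) with position {e = e} {f} g d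
  ... | same₁ s          = ac (s χ)
  ... | same₂ s          = bc (s χ)
  ... | close₁ c         = not-close {e} {f} {g} d distinct c
  ... | close₂ c         = not-close {f} {e} {g} (Apart-sym {e = e} {f} d) (rotate₃ distinct) c
  ... | away a b         = not-away {e} {f} {g} d distinct a b
  ... | touch₁ i j t a   = not-touching {e} {f} {g} d distinct i j t a
  ... | touch₂ i j t a   = not-touching {f} {e} {g} (Apart-sym {e = e} {f} d) (rotate₃ distinct) i j t a
  ... | cross i j k p q  = not-cross {e} {f} {g} d distinct i j k p q

  -- With at least three colours in use, any two colours have a third beside them, which
  -- `no-third-colour` forbids.
  apart-colours : ∀ {k} (f : Fin (3 + k) → DTriple n) → (∀ i j → colOf χ (f i) ≡ colOf χ (f j) → i ≡ j) →
                     ∀ {e g} → Apart e g → colOf χ e ≡ colOf χ g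
  apart-colours f inj {e} {g} d with colOf χ e ≟ℕ colOf χ g
  ... | yes p = p
  ... | no a≢b with third-of (λ i → colOf χ (f i)) inj (colOf χ e) (colOf χ g)
  ...   | i , p , q = ⊥-elim (no-third-colour {e} {g} {f i} d (distinct₃ a≢b p q))

messy-upper : ∀ {n} → 7 ≤ n → Forces n messyPath 3
messy-upper {n} 7≤n = forces λ χ (f , inj) free → contradict χ f inj free
  where
  module _ (χ : Colouring n) (f : Fin 3 → DTriple n)
           (inj : ∀ i j → colOf χ (f i) ≡ colOf χ (f j) → i ≡ j) (free : ¬ HasRainbowCopy χ messyPath) where
    open Messy χ free

    step : ∀ e g → Apart e g → colOf χ e ≡ colOf χ g
    step e g = apart-colours f inj {e} {g}

    monochromatic : ∀ e g → colOf χ e ≡ colOf χ g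
    monochromatic e g with pair e g
    ... | same s  = s χ
    ... | apart a = step e g a
    ... | close (x , y , u , v , i , j , u≢v) with fresh₂ (close-unique i j u≢v) (<-trans (n<1+n _) 7≤n)
    ...   | p , q , U with fresh _ 7≤n
    -- Three fresh vertices form a triple disjoint from both `e` and `g`.
    ...     | r , r∉ = let V = r∉ ∷ᵘ U ; m = at V (# 0) (# 1) (# 2) ; m-is = at-is V (# 0) (# 1) (# 2) in
      trans (step e m (apart-at V (# 3 , # 4 , # 5) (# 0 , # 1 , # 2) i m-is))
            (sym (step g m (apart-at V (# 3 , # 4 , # 6) (# 0 , # 1 , # 2) j m-is)))
    monochromatic e g | touching i j t with fresh₂ (touch-unique i j t) 7≤n
    ...   | p , q , U =
      -- The walk through disjoint triples is xuv, wzp, uvq, xwz.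
      let m = at U (# 5) (# 6) (# 0) ; m-is = at-is U (# 5) (# 6) (# 0)
          m′ = at U (# 3) (# 4) (# 1) ; m′-is = at-is U (# 3) (# 4) (# 1)
      in trans (step e m (apart-at U (# 2 , # 3 , # 4) (# 5 , # 6 , # 0) i m-is))
           (trans (step m m′ (apart-at U (# 5 , # 6 , # 0) (# 3 , # 4 , # 1) m-is m′-is))
                  (step m′ g (apart-at U (# 3 , # 4 , # 1) (# 2 , # 5 , # 6) m′-is j)))

    contradict : ⊥
    contradict with inj zero (suc zero) (monochromatic (f zero) (f (suc zero)))
    ... | ()

edge : ∀ {n} (a b c : Fin n) → {True (DecUnique.unique? _≟F_ (a ∷ b ∷ c ∷ []))} → DTriple n
edge a b c {d} with toWitness d
... | (ab ∷ ac ∷ []) ∷ (bc ∷ []) ∷ _ = dtriple a b c ab ac bc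

-- One triple from each complementary pair.
halves : Vec (DTriple 6) 10
halves =
  edge (# 0) (# 1) (# 2) ∷ edge (# 0) (# 1) (# 3) ∷ edge (# 0) (# 1) (# 4) ∷ edge (# 0) (# 1) (# 5) ∷ edge (# 0) (# 2) (# 3) ∷
  edge (# 0) (# 2) (# 4) ∷ edge (# 0) (# 2) (# 5) ∷ edge (# 0) (# 3) (# 4) ∷ edge (# 0) (# 3) (# 5) ∷ edge (# 0) (# 4) (# 5) ∷ []

abstract
  -- Established by evaluation over all triples; `abstract` prevents that search from unfolding in
  -- later goals.
  halved : ∀ e → ∃ λ i → let h = vertices (Vec.lookup halves i) in
           All (_∈ h) (vertices e) ⊎ All (_∉ h) (vertices e)
  halved e = toWitness {a? = decide} tt (t1 e) (t2 e) (t3 e) (d12 e) (d13 e) (d23 e)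
    where
    decide : Dec (∀ a b c → a ≢ b → a ≢ c → b ≢ c → ∃ λ i → let h = vertices (Vec.lookup halves i) in
                  All (_∈ h) (a ∷ b ∷ c ∷ []) ⊎ All (_∉ h) (a ∷ b ∷ c ∷ []))
    decide = all? λ a → all? λ b → all? λ c → ¬? (a ≟F b) →-dec (¬? (a ≟F c) →-dec (¬? (b ≟F c) →-dec
      any? λ i → let h = vertices (Vec.lookup halves i) in
        All.all? (_∈F? h) (a ∷ b ∷ c ∷ []) ⊎-dec All.all? (λ v → ¬? (v ∈F? h)) (a ∷ b ∷ c ∷ [])))

-- Complementary triples have equal colours, so colours factor through the ten `halves`, and two of
-- eleven representatives collide.
messy-upper₆ : Forces 6 messyPath 11
messy-upper₆ = forces λ χ (f , inj) free → contradict χ f inj free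
  where
  module _ (χ : Colouring 6) (f : Fin 11 → DTriple 6)
           (inj : ∀ i j → colOf χ (f i) ≡ colOf χ (f j) → i ≡ j) (free : ¬ HasRainbowCopy χ messyPath) where
    open Messy χ free

    half-colour : ∀ e → colOf χ e ≡ colOf χ (Vec.lookup halves (proj₁ (halved e)))
    half-colour e with halved e
    ... | i , inj₁ ins  = ⊆⇒same {e = e} {Vec.lookup halves i} ins χ
    ... | i , inj₂ outs = apart-colours f inj {e} {Vec.lookup halves i} (disjoint⇒apart {e = e} {Vec.lookup halves i} outs)

    contradict : ⊥
    contradict with pigeonhole (n<1+n 10) (λ i → proj₁ (halved (f i)))
    ... | i , j , i<j , eq = <⇒≢ i<j (inj i j
      (trans (half-colour (f i)) (trans (cong (λ k → colOf χ (Vec.lookup halves k)) eq) (sym (half-colour (f j))))))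

-- Loose paths

-- The pairs (missing, outer) agree two by two in exactly one coordinate, hence lie in one row or in one column.
module Rook {n m} (g : Fin (suc m) → DTriple n) (4≤m : 4 ≤ m) (n<3+m : n <ℕ 3 + m)
            (close : ∀ {i j} → i ≢ j → Close (g i) (g j)) where

  -- Describes `f` as `g zero` with the vertex `missing` exchanged for `outer`.
  record Move (f : DTriple n) : Set where
    field
      missing outer  : Fin n
      missing∈ : missing ∈ vertices (g zero)
      outer∉   : outer ∉ vertices (g zero)
      outer∈   : outer ∈ vertices f
      kept     : ∀ {v} → v ∈ vertices (g zero) → v ≢ missing → v ∈ vertices f
      comes    : ∀ {v} → v ∈ vertices f → v ≡ outer ⊎ (v ∈ vertices (g zero) × v ≢ missing)

  move : ∀ {f} → Close (g zero) f → Move f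
  move {f} (x , y , z , w , i , k , z≢w) = record
    { missing = z ; outer = w ; missing∈ = from i 3rd ; outer∉ = new-vertex i k z≢w ; outer∈ = from k 3rd
    ; kept = λ v∈ v≢z → kept (to i v∈) v≢z ; comes = comes ∘ to k }
    where
    kept : ∀ {v} → v ∈ x ∷ y ∷ z ∷ [] → v ≢ z → v ∈ vertices f
    kept 1st _ = from k 1st
    kept 2nd _ = from k 2nd
    kept 3rd n = contradiction refl n
    comes : ∀ {v} → v ∈ x ∷ y ∷ w ∷ [] → v ≡ w ⊎ (v ∈ vertices (g zero) × v ≢ z)
    comes 1st with unique i
    ... | (_ ∷ n ∷ _) ∷ _ = inj₂ (from i 1st , n)
    comes 2nd with unique i
    ... | _ ∷ (n ∷ _) ∷ _ = inj₂ (from i 2nd , n)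
    comes 3rd = inj₁ refl

  open Move

  moves : ∀ i → Move (g (suc i))
  moves i = move (close λ ())

  suc≢ : ∀ {k} {i j : Fin k} → i ≢ j → suc i ≢ suc j
  suc≢ n refl = n refl

  -- If both coordinates agreed, the two triples would have the same vertices, although close
  -- triples differ in one.
  same-row : ∀ {i j} → i ≢ j → missing (moves i) ≡ missing (moves j) → outer (moves i) ≢ outer (moves j)
  same-row {i} {j} i≢j same-missing same-outer with close (suc≢ i≢j)
  ... | p , q , r , t , k , l , r≢t = new-vertex l k (≢-sym r≢t) (shared (comes (moves i) (from k 3rd)))
    where
    shared : r ≡ outer (moves i) ⊎ (r ∈ vertices (g zero) × r ≢ missing (moves i)) → r ∈ vertices (g (suc j))
    shared (inj₁ e)       = subst (_∈ vertices (g (suc j))) (sym (trans e same-outer)) (outer∈ (moves j))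
    shared (inj₂ (r∈ , n)) = kept (moves j) r∈ (λ e → n (trans e (sym same-missing)))

  -- If both coordinates differed, the only common vertex would be the remaining vertex `r` of
  -- `g zero`, while close triples share two.
  same-column : ∀ {i j} → i ≢ j → missing (moves i) ≢ missing (moves j) → outer (moves i) ≡ outer (moves j)
  same-column {i} {j} i≢j differ with outer (moves i) ≟F outer (moves j)
  ... | yes p = p
  ... | no outer≢ with close (suc≢ i≢j) | leading₂ {e = g zero} (missing∈ (moves i)) (missing∈ (moves j)) differ
  ...   | p , q , _ , _ , k , l , _ | r , h with unique k
  ...     | (p≢q ∷ _) ∷ _ = ⊥-elim (p≢q (trans (only (from k 1st) (from l 1st)) (sym (only (from k 2nd) (from l 2nd)))))
    where
    only : ∀ {v} → v ∈ vertices (g (suc i)) → v ∈ vertices (g (suc j)) → v ≡ r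
    only v∈ v∈′ with comes (moves i) v∈ | comes (moves j) v∈′
    ... | inj₁ e        | inj₁ e′       = contradiction (trans (sym e) e′) outer≢
    ... | inj₁ refl     | inj₂ (v∈₀ , _) = contradiction v∈₀ (outer∉ (moves i))
    ... | inj₂ (v∈₀ , _) | inj₁ refl     = contradiction v∈₀ (outer∉ (moves j))
    ... | inj₂ (v∈₀ , n) | inj₂ (_ , n′) with to h v∈₀
    ...   | 1st = contradiction refl n
    ...   | 2nd = contradiction refl n′
    ...   | 3rd = refl

  -- A move off the row would share its outer vertex with both `i` and `j`, whose outer vertices
  -- differ.
  one-row : ∀ {i j} → i ≢ j → missing (moves i) ≡ missing (moves j) → ∀ k → missing (moves k) ≡ missing (moves i)
  one-row {i} {j} i≢j e k with missing (moves k) ≟F missing (moves i)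
  ... | yes p = p
  ... | no n  = contradiction
    (trans (sym (same-column (λ { refl → n refl }) n)) (same-column (λ { refl → n (sym e) }) (λ p → n (trans p (sym e)))))
    (same-row i≢j e)

  -- The m outer vertices and the three of `g zero` would be 3 + m distinct vertices.
  many-outer : (∀ {i j} → i ≢ j → outer (moves i) ≢ outer (moves j)) → ⊥
  many-outer injective = <⇒≱ n<3+m (subst (_≤ n) (cong (3 +_) (length-tabulate (outer ∘ moves)))
    (Unique⇒length≤ (Uniqueₚ.++⁺ (unique (is-itself (g zero))) (Uniqueₚ.tabulate⁺ (λ {i} {j} e → inj i j e)) disjoint)))
    where
    inj : ∀ i j → outer (moves i) ≡ outer (moves j) → i ≡ j
    inj i j e with i ≟F j
    ... | yes p = p
    ... | no n  = contradiction e (injective n)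
    disjoint : ∀ {v} → ¬ (v ∈ vertices (g zero) × v ∈ tabulate (outer ∘ moves))
    disjoint (v∈ , v∈′) with ∈-tabulate⁻ v∈′
    ... | i , refl = outer∉ (moves i) v∈

  absurd : ⊥
  absurd with any? (λ i → any? λ j → ¬? (i ≟F j) ×-dec (missing (moves i) ≟F missing (moves j)))
  ... | yes (i , j , i≢j , e) =
    many-outer λ {k} {l} k≢l → same-row k≢l (trans (one-row i≢j e k) (sym (one-row i≢j e l)))
  -- Here all missing vertices are distinct, yet `g zero` has only three vertices.
  ... | no ¬same = <⇒≱ 4≤m (injective⇒≤ {f = Any.index ∘ missing∈ ∘ moves} λ {i} {j} e →
                    inj i j (index-injective (missing∈ (moves i)) (missing∈ (moves j)) e))
    where
    inj : ∀ i j → missing (moves i) ≡ missing (moves j) → i ≡ j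
    inj i j e with i ≟F j
    ... | yes p = p
    ... | no n  = contradiction (i , j , n , e) ¬same

module Loose {n} (χ : Colouring n) (7≤n : 7 ≤ n) (free : ¬ HasRainbowCopy χ loosePath) where

  module _ {e f g : DTriple n} (d : Apart e f) (distinct : Unique (colOf χ e ∷ colOf χ f ∷ colOf χ g ∷ [])) where

    -- Positions: w, z, x, u, v, then f1, f2, f3 from `f`. As a middle edge, v f1 w is forced to the
    -- colour of `f`; then u f2 f3 must have the colour of `e`, and no colour is left for x v f2.
    not-touching : ∀ {x u v w z} → e is (x , u , v) → g is (x , w , z) → Touching e g x → ¬ Apart f g
    not-touching {w = w} {z} i j t a with unique j
    ... | (x≢w ∷ x≢z ∷ []) ∷ (w≢z ∷ []) ∷ _ =
      refuted χ free ((λ { 1st → w≢z refl ; (there p) → out x≢w (from j 2nd) p }) ∷ᵘ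
                      (out x≢z (from j 3rd) ∷ᵘ six d i (is-itself f))) distinct
        ((# 2 , # 3 , # 4) ∷ (# 5 , # 6 , # 7) ∷ (# 2 , # 0 , # 1) ∷ [])
        ((# 4 , # 5 , # 0) ∷ (# 3 , # 6 , # 7) ∷ (# 2 , # 4 , # 6) ∷ [])
        (sym (value i χ) ∷ refl ∷ sym (value j χ) ∷ []) (certified _)
      where
      out : ∀ {s} → _ ≢ s → s ∈ vertices g → s ∉ _
      out x≢s s∈g = outside i (is-itself f) (λ s∈e → x≢s (sym (t s∈e s∈g))) (λ s∈f → a (s∈f , s∈g))

    -- A triple with one vertex in each of the three can be the middle edge between any two of them;
    -- whichever of the three colours it has, the other two triples complete a rainbow path.
    not-away : Apart e g → ¬ Apart f g
    not-away a b = refuted χ free (Uniqueₚ.++⁺ (six d (is-itself e) (is-itself f)) (unique (is-itself g))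
                                   λ (p , q) → [ (λ p → a (p , q)) , (λ p → b (p , q)) ]′ (Anyₚ.++⁻ (vertices e) p)) distinct
      ((# 0 , # 1 , # 2) ∷ (# 3 , # 4 , # 5) ∷ (# 6 , # 7 , # 8) ∷ []) ((# 0 , # 3 , # 6) ∷ [])
      (refl ∷ refl ∷ refl ∷ []) (certified _)

    -- Here `g` itself is the middle edge of a loose path from `e` to `f`.
    not-cross : ∀ {x y z u v w p} → e is (x , y , z) → f is (u , v , w) → g is (x , u , p) →
                p ∉ vertices e → p ∉ vertices f → ⊥
    not-cross i j k p∉e p∉f = refuted χ free (outside i j p∉e p∉f ∷ᵘ six d i j) distinct
      ((# 1 , # 2 , # 3) ∷ (# 4 , # 5 , # 6) ∷ (# 1 , # 4 , # 0) ∷ []) []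
      (sym (value i χ) ∷ sym (value j χ) ∷ sym (value k χ) ∷ []) (certified _)

  third-is-close : ∀ e f g → Apart e f → Unique (colOf χ e ∷ colOf χ f ∷ colOf χ g ∷ []) → Close e g ⊎ Close f g
  third-is-close e f g d distinct@((_ ∷ ac ∷ []) ∷ (bc ∷ []) ∷ _) with position {e = e} {f} g d
  ... | same₁ s          = contradiction (s χ) ac
  ... | same₂ s          = contradiction (s χ) bc
  ... | close₁ c         = inj₁ c
  ... | close₂ c         = inj₂ c
  ... | away a b         = ⊥-elim (not-away {e} {f} {g} d distinct a b)
  ... | touch₁ i j t a   = ⊥-elim (not-touching {e} {f} {g} d distinct i j t a)
  ... | touch₂ i j t a   = ⊥-elim (not-touching {f} {e} {g} (Apart-sym {e = e} {f} d) (rotate₃ distinct) i j t a)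
  ... | cross i j k p q  = ⊥-elim (not-cross {e} {f} {g} d distinct i j k p q)

  -- In each case the guessed triple can be the middle edge both between `e` and `f` and between `g`
  -- and `h`. Its colour would have to occur in both pairs, which share none.
  close-apart : ∀ {e f g h : DTriple n} → Close e g → Close f h → Apart e f → Apart g h →
                Unique (colOf χ e ∷ colOf χ f ∷ colOf χ g ∷ colOf χ h ∷ []) → ⊥
  close-apart {e} {f} {g} {h} (x , y , z , s , i , k , z≢s) (u , v , w , t , j , l , w≢t) ef gh distinct =
    locate (s ∈F? vertices f) (t ∈F? vertices e)
    where
    s≡w : s ∈ vertices f → s ≡ w
    s≡w s∈f with to j s∈f
    ... | 1st = ⊥-elim (gh (from k 3rd , from l 1st))
    ... | 2nd = ⊥-elim (gh (from k 3rd , from l 2nd))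
    ... | 3rd = refl
    t≡z : t ∈ vertices e → t ≡ z
    t≡z t∈e with to i t∈e
    ... | 1st = ⊥-elim (gh (from k 1st , from l 3rd))
    ... | 2nd = ⊥-elim (gh (from k 2nd , from l 3rd))
    ... | 3rd = refl
    locate : Dec (s ∈ vertices f) → Dec (t ∈ vertices e) → ⊥
    locate (no s∉f) (no t∉e) =
      refuted χ free ((λ { 1st → gh (from k 3rd , from l 3rd) ; (there p) → outside i j (new-vertex i k z≢s) s∉f p }) ∷ᵘ
                      (outside i j t∉e (new-vertex j l w≢t) ∷ᵘ six ef i j)) distinct
        ((# 2 , # 3 , # 4) ∷ (# 5 , # 6 , # 7) ∷ (# 2 , # 3 , # 0) ∷ (# 5 , # 6 , # 1) ∷ []) ((# 2 , # 7 , # 1) ∷ [])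
        (sym (value i χ) ∷ sym (value j χ) ∷ sym (value k χ) ∷ sym (value l χ) ∷ []) (certified _)
    locate (no s∉f) (yes t∈e) with t≡z t∈e
    ... | refl = refuted χ free (outside i j (new-vertex i k z≢s) s∉f ∷ᵘ six ef i j) distinct
        ((# 1 , # 2 , # 3) ∷ (# 4 , # 5 , # 6) ∷ (# 1 , # 2 , # 0) ∷ (# 4 , # 5 , # 3) ∷ []) ((# 3 , # 6 , # 0) ∷ [])
        (sym (value i χ) ∷ sym (value j χ) ∷ sym (value k χ) ∷ sym (value l χ) ∷ []) (certified _)
    locate (yes s∈f) (no t∉e) with s≡w s∈f
    ... | refl = refuted χ free (outside i j t∉e (new-vertex j l w≢t) ∷ᵘ six ef i j) distinct
        ((# 1 , # 2 , # 3) ∷ (# 4 , # 5 , # 6) ∷ (# 1 , # 2 , # 6) ∷ (# 4 , # 5 , # 0) ∷ []) ((# 3 , # 6 , # 0) ∷ [])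
        (sym (value i χ) ∷ sym (value j χ) ∷ sym (value k χ) ∷ sym (value l χ) ∷ []) (certified _)
    locate (yes s∈f) (yes t∈e) with s≡w s∈f | t≡z t∈e | fresh (x ∷ y ∷ z ∷ u ∷ v ∷ w ∷ []) 7≤n
    ... | refl | refl | r , r∉ = refuted χ free (r∉ ∷ᵘ six ef i j) distinct
        ((# 1 , # 2 , # 3) ∷ (# 4 , # 5 , # 6) ∷ (# 1 , # 2 , # 6) ∷ (# 4 , # 5 , # 3) ∷ []) ((# 0 , # 1 , # 4) ∷ [])
        (sym (value i χ) ∷ sym (value j χ) ∷ sym (value k χ) ∷ sym (value l χ) ∷ []) (certified _)

  -- With `r` fresh, zwr is a middle edge between `e` and `f`, so it has one of their colours. The
  -- colour of `e` is refuted by the path zwr, `f`, `g`, that of `f` by zwr, `e`, `h`.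
  linked-sides : ∀ {e f g h : DTriple n} {x y z u v w} → Apart e f →
                 e is (x , y , z) → f is (u , v , w) → g is (x , y , u) → h is (u , v , x) →
                 Unique (colOf χ e ∷ colOf χ f ∷ colOf χ g ∷ colOf χ h ∷ []) → ⊥
  linked-sides {x = x} {y} {z} {u} {v} {w} ef i j k l distinct with fresh (x ∷ y ∷ z ∷ u ∷ v ∷ w ∷ []) 7≤n
  ... | r , r∉ = refuted χ free (r∉ ∷ᵘ six ef i j) distinct
        ((# 1 , # 2 , # 3) ∷ (# 4 , # 5 , # 6) ∷ (# 1 , # 2 , # 4) ∷ (# 4 , # 5 , # 1) ∷ []) ((# 3 , # 6 , # 0) ∷ [])
        (sym (value i χ) ∷ sym (value j χ) ∷ sym (value k χ) ∷ sym (value l χ) ∷ []) (certified _)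

  -- As `e` and `f` are disjoint, two common vertices of `g` and `h` can only be t in {x, y} and s
  -- in {u, v}. Up to order this is `linked-sides`.
  close-sides : ∀ {e f g h : DTriple n} → Apart e f → Close e g → Close f h → Close g h →
                Unique (colOf χ e ∷ colOf χ f ∷ colOf χ g ∷ colOf χ h ∷ []) → ⊥
  close-sides {e} {f} {g} {h} ef (x , y , z , s , i , k , _) (u , v , w , t , j , l , _) (p , q , _ , _ , m , o , _) distinct
    with unique m
  ... | (p≢q ∷ _) ∷ _ = locate (to k (from m 1st)) (to k (from m 2nd)) (to l (from o 1st)) (to l (from o 2nd)) p≢q
    where
    apart-side : ∀ {r} → r ∈ x ∷ y ∷ z ∷ [] → r ∉ u ∷ v ∷ w ∷ []
    apart-side r∈ r∈′ = ef (from i r∈ , from j r∈′)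
    cross-over : t ∈ x ∷ y ∷ [] → s ∈ u ∷ v ∷ [] → ⊥
    cross-over 1st 1st = linked-sides {e} {f} {g} {h} ef i j k l distinct
    cross-over 1st 2nd = linked-sides {e} {f} {g} {h} ef i (swap₁₂ j) k (swap₁₂ l) distinct
    cross-over 2nd 1st = linked-sides {e} {f} {g} {h} ef (swap₁₂ i) j (swap₁₂ k) l distinct
    cross-over 2nd 2nd = linked-sides {e} {f} {g} {h} ef (swap₁₂ i) (swap₁₂ j) (swap₁₂ k) (swap₁₂ l) distinct
    in-e : ∀ {r} → r ∈ x ∷ y ∷ s ∷ [] → r ∈ u ∷ v ∷ t ∷ [] → (r ≡ t × t ∈ x ∷ y ∷ []) ⊎ (r ≡ s)
    in-e 3rd _ = inj₂ refl
    in-e 1st 1st = ⊥-elim (apart-side 1st 1st)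
    in-e 1st 2nd = ⊥-elim (apart-side 1st 2nd)
    in-e 1st 3rd = inj₁ (refl , 1st)
    in-e 2nd 1st = ⊥-elim (apart-side 2nd 1st)
    in-e 2nd 2nd = ⊥-elim (apart-side 2nd 2nd)
    in-e 2nd 3rd = inj₁ (refl , 2nd)
    in-f : ∀ {r} → r ∈ u ∷ v ∷ t ∷ [] → r ≢ t → r ∈ u ∷ v ∷ []
    in-f 1st _ = 1st
    in-f 2nd _ = 2nd
    in-f 3rd n = contradiction refl n
    locate : p ∈ x ∷ y ∷ s ∷ [] → q ∈ x ∷ y ∷ s ∷ [] → p ∈ u ∷ v ∷ t ∷ [] → q ∈ u ∷ v ∷ t ∷ [] → p ≢ q → ⊥
    locate p∈ q∈ p∈′ q∈′ p≢q with in-e p∈ p∈′ | in-e q∈ q∈′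
    ... | inj₁ (p≡t , t∈) | inj₁ (q≡t , _) = p≢q (trans p≡t (sym q≡t))
    ... | inj₂ p≡s        | inj₂ q≡s       = p≢q (trans p≡s (sym q≡s))
    ... | inj₁ (refl , t∈) | inj₂ refl     = cross-over t∈ (in-f q∈′ (≢-sym p≢q))
    ... | inj₂ refl       | inj₁ (refl , t∈) = cross-over t∈ (in-f p∈′ p≢q)

  no-matching : ∀ e f g h → Apart e f → Apart g h →
                Unique (colOf χ e ∷ colOf χ f ∷ colOf χ g ∷ colOf χ h ∷ []) → ⊥
  no-matching e f g h ef gh distinct@((ab ∷ ac ∷ ad ∷ []) ∷ (bc ∷ bd ∷ []) ∷ (cd ∷ []) ∷ _)
    with third-is-close e f g ef (distinct₃ ab (≢-sym ac) (≢-sym bc))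
       | third-is-close e f h ef (distinct₃ ab (≢-sym ad) (≢-sym bd))
  ... | inj₁ p | inj₁ q = close-common {e = e} {g} {h} p q gh
  ... | inj₂ p | inj₂ q = close-common {e = f} {g} {h} p q gh
  ... | inj₁ p | inj₂ q = close-apart {e} {f} {g} {h} p q ef gh distinct
  ... | inj₂ p | inj₁ q = close-apart {f} {e} {g} {h} p q (Apart-sym {e = e} {f} ef) gh
    ((≢-sym ab ∷ bc ∷ bd ∷ []) ∷ (ac ∷ ad ∷ []) ∷ (cd ∷ []) ∷ [] ∷ [])

  -- The disjoint triples need not be the chosen representatives of the two colours.
  Spread : ℕ → ℕ → Set
  Spread a b = ∃₂ λ (e f : DTriple n) → Apart e f × colOf χ e ≡ a × colOf χ f ≡ b

  -- Each inspected triple extends a loose path of two edges coloured a and b, so it has colour a or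
  -- b. One answer gives a disjoint pair at once, the other feeds the next step; for xpq both give
  -- one.
  touching-spread : ∀ {e f : DTriple n} {x u v w z} → e is (x , u , v) → f is (x , w , z) → Touching e f x →
                    colOf χ e ≢ colOf χ f → Spread (colOf χ e) (colOf χ f)
  touching-spread {e} {f} {x} {u} {v} {w} {z} i j t a≢b with fresh₂ (touch-unique {e = e} {f} i j t) 7≤n
  ... | p , q , U = step₁
    where
    xs = p ∷ q ∷ x ∷ u ∷ v ∷ w ∷ z ∷ []
    a = colOf χ e
    b = colOf χ f
    known : ∀ r s t → colour χ xs r ≡ a → colour χ xs s ≡ b → Refutes loosePath (r ∷ s ∷ t ∷ []) [] →
            colour χ xs t ≡ a ⊎ colour χ xs t ≡ b
    known r s t ra sb cert with one-of a b (colour χ xs t)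
    ... | inj₁ k = k
    ... | inj₂ (n₁ , n₂) = ⊥-elim (refuted χ free U (distinct₃ a≢b n₁ n₂) (r ∷ s ∷ t ∷ []) [] (ra ∷ sb ∷ refl ∷ []) cert)
    spread : ∀ ((i , j , k) (l , m , o) : Triple 7) →
             {d : True (DecUnique.unique? _≟F_ (i ∷ j ∷ k ∷ []))} {d′ : True (DecUnique.unique? _≟F_ (l ∷ m ∷ o ∷ []))} →
             {True (DecUnique.unique? _≟F_ (i ∷ j ∷ k ∷ l ∷ m ∷ o ∷ []))} →
             colour χ xs (i , j , k) ≡ a → colour χ xs (l , m , o) ≡ b → Spread a b
    spread r@(i , j , k) s@(l , m , o) {d} {d′} {d″} ra sb =
      at U i j k {d} , at U l m o {d′} , apart-at U r s {at U i j k {d}} {at U l m o {d′}} {d″} (at-is U i j k) (at-is U l m o) ,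
      trans (value (at-is U i j k) χ) ra , trans (value (at-is U l m o) χ) sb
    XUV XWZ UPQ WPQ VWZ UVZ XPQ : Triple 7
    XUV = # 2 , # 3 , # 4
    XWZ = # 2 , # 5 , # 6
    UPQ = # 3 , # 0 , # 1
    WPQ = # 5 , # 0 , # 1
    VWZ = # 4 , # 5 , # 6
    UVZ = # 3 , # 4 , # 6
    XPQ = # 2 , # 0 , # 1
    xuv : colour χ xs XUV ≡ a
    xuv = sym (value i χ)
    xwz : colour χ xs XWZ ≡ b
    xwz = sym (value j χ)
    step₅ : colour χ xs UVZ ≡ a → colour χ xs VWZ ≡ b → Spread a b
    step₅ uvz vwz with one-of a b (colour χ xs XPQ)
    ... | inj₁ (inj₁ xpq) = spread XPQ VWZ xpq vwz
    ... | inj₁ (inj₂ xpq) = spread UVZ XPQ uvz xpq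
    ... | inj₂ (n₁ , n₂)  = ⊥-elim (refuted χ free U (distinct₃ a≢b n₁ n₂)
          (XUV ∷ VWZ ∷ XPQ ∷ []) [] (xuv ∷ vwz ∷ refl ∷ []) (certified _))
    step₄ : colour χ xs WPQ ≡ a → colour χ xs VWZ ≡ b → Spread a b
    step₄ wpq vwz with known WPQ XWZ UVZ wpq xwz (certified _)
    ... | inj₁ uvz = step₅ uvz vwz
    ... | inj₂ uvz = spread WPQ UVZ wpq uvz
    step₃ : colour χ xs UPQ ≡ b → colour χ xs WPQ ≡ a → Spread a b
    step₃ upq wpq with known XUV UPQ VWZ xuv upq (certified _)
    ... | inj₁ vwz = spread VWZ UPQ vwz upq
    ... | inj₂ vwz = step₄ wpq vwz
    step₂ : colour χ xs UPQ ≡ b → Spread a b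
    step₂ upq with known XUV XWZ WPQ xuv xwz (certified _)
    ... | inj₁ wpq = step₃ upq wpq
    ... | inj₂ wpq = spread XUV WPQ xuv wpq
    step₁ : Spread a b
    step₁ with known XUV XWZ UPQ xuv xwz (certified _)
    ... | inj₁ upq = spread UPQ XWZ upq xwz
    ... | inj₂ upq = step₂ upq

  ¬close⇒spread : ∀ {e f : DTriple n} → colOf χ e ≢ colOf χ f → Spread (colOf χ e) (colOf χ f) ⊎ Close e f
  ¬close⇒spread {e} {f} a≢b with pair e f
  ... | same s           = contradiction (s χ) a≢b
  ... | close c          = inj₂ c
  ... | touching i j t   = inj₁ (touching-spread {e} {f} i j t a≢b)
  ... | apart d          = inj₁ (e , f , d , refl , refl)

search : ∀ {k} {P Q : Fin k → Set} → (∀ i → P i ⊎ Q i) → ∃ P ⊎ (∀ i → Q i)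
search {zero}  h = inj₂ λ ()
search {suc k} h with h zero | search (h ∘ suc)
... | inj₁ p | _            = inj₁ (zero , p)
... | inj₂ _ | inj₁ (i , p) = inj₁ (suc i , p)
... | inj₂ q | inj₂ qs      = inj₂ λ { zero → q ; (suc i) → qs i }

loose-upper : ∀ {n} → 7 ≤ n → Forces n loosePath n
loose-upper {suc zero} (s≤s ())
loose-upper {suc (suc m)} 7≤n = forces λ χ (f , inj) free → contradict χ f inj free
  where
  n = suc (suc m)
  module _ (χ : Colouring n) (f : Fin n → DTriple n)
           (inj : ∀ i j → colOf χ (f i) ≡ colOf χ (f j) → i ≡ j) (free : ¬ HasRainbowCopy χ loosePath) where
    open Loose χ 7≤n free

    4≤m : 4 ≤ m
    4≤m = ≤-trans (n≤1+n 4) (s≤s⁻¹ (s≤s⁻¹ 7≤n))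

    differ : ∀ {i j} → i ≢ j → colOf χ (f i) ≢ colOf χ (f j)
    differ i≢j e = i≢j (inj _ _ e)

    module _ {i j} (i≢j : i ≢ j) (e g : DTriple n) (e-g : Apart e g)
             (ei : colOf χ e ≡ colOf χ (f i)) (gj : colOf χ g ≡ colOf χ (f j)) where

      distinct : ∀ {k} → k ≢ i → k ≢ j → Unique (colOf χ e ∷ colOf χ g ∷ colOf χ (f k) ∷ [])
      distinct {k} k≢i k≢j = distinct₃ (λ p → differ i≢j (trans (sym ei) (trans p gj)))
        (λ p → differ k≢i (trans p ei)) (λ p → differ k≢j (trans p gj))

      distinct′ : ∀ {k l} → k ≢ i → k ≢ j → l ≢ i → l ≢ j → k ≢ l →
                  Unique (colOf χ e ∷ colOf χ g ∷ colOf χ (f k) ∷ colOf χ (f l) ∷ [])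
      distinct′ {k} {l} k≢i k≢j l≢i l≢j k≢l with distinct k≢i k≢j | distinct l≢i l≢j
      ... | (ab ∷ ac ∷ []) ∷ (bc ∷ []) ∷ _ | (_ ∷ ad ∷ []) ∷ (bd ∷ []) ∷ _ =
        (ab ∷ ac ∷ ad ∷ []) ∷ (bc ∷ bd ∷ []) ∷ (differ k≢l ∷ []) ∷ [] ∷ []

      -- Otherwise the two colours occur on disjoint triples, which `no-matching` forbids next to
      -- `e` and `g`.
      others-close : ∀ {k l} → k ≢ i → k ≢ j → l ≢ i → l ≢ j → k ≢ l → Close (f k) (f l)
      others-close {k} {l} k≢i k≢j l≢i l≢j k≢l with ¬close⇒spread {f k} {f l} (differ k≢l)
      ... | inj₂ c = c
      ... | inj₁ (e′ , g′ , d , p , q) = ⊥-elim (no-matching e g e′ g′ e-g d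
        (subst Unique (cong₂ (λ c d → colOf χ e ∷ colOf χ g ∷ c ∷ d ∷ []) (sym p) (sym q))
                      (distinct′ k≢i k≢j l≢i l≢j k≢l)))

      -- Since `f k` is close to `e`, `close-sides` keeps every other representative on the side of
      -- `e`, so all these triples are pairwise close.
      one-sided : ∀ {k} → k ≢ i → k ≢ j → Close e (f k) → ⊥
      -- `punchIn j` drops index `j` and `member` puts `e` in place of `f i`, which gives n - 1
      -- triples.
      one-sided {k} k≢i k≢j ek = Rook.absurd (member ∘ punchIn j) 4≤m (n<1+n _)
        λ {s} {t} s≢t → members-close _ _ (punchInᵢ≢i j s) (punchInᵢ≢i j t) (λ p → s≢t (punchIn-injective j s t p))
        where
        sided : ∀ l → l ≢ i → l ≢ j → Close e (f l)
        sided l l≢i l≢j with third-is-close e g (f l) e-g (distinct l≢i l≢j) | l ≟F k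
        ... | inj₁ c | _        = c
        ... | inj₂ _ | yes refl = ek
        ... | inj₂ c | no l≢k   = ⊥-elim (close-sides {e} {g} {f k} {f l} e-g ek c
                                   (others-close k≢i k≢j l≢i l≢j (≢-sym l≢k)) (distinct′ k≢i k≢j l≢i l≢j (≢-sym l≢k)))
        member : Fin n → DTriple n
        member l with l ≟F i
        ... | yes _ = e
        ... | no _  = f l
        members-close : ∀ s t → s ≢ j → t ≢ j → s ≢ t → Close (member s) (member t)
        members-close s t s≢j t≢j s≢t with s ≟F i | t ≟F i
        ... | yes p | yes q = contradiction (trans p (sym q)) s≢t
        ... | yes _ | no q  = sided t q t≢j
        ... | no p  | yes _ = Close-sym {e = e} {f s} (sided s p s≢j)
        ... | no p  | no q  = others-close p s≢j q t≢j s≢t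

    scattered : ∃₂ λ i j → i ≢ j × Spread (colOf χ (f i)) (colOf χ (f j))
    scattered with search (λ i → search (classify i))
      where
      classify : ∀ i j → (suc i ≢ suc j × Spread (colOf χ (f (suc i))) (colOf χ (f (suc j)))) ⊎
                         (i ≢ j → Close (f (suc i)) (f (suc j)))
      classify i j with i ≟F j
      ... | yes p = inj₂ λ n → contradiction p n
      ... | no i≢j with ¬close⇒spread {f (suc i)} {f (suc j)} (differ (i≢j ∘ suc-injective))
      ...   | inj₁ s = inj₁ (i≢j ∘ suc-injective , s)
      ...   | inj₂ c = inj₂ λ _ → c
    ... | inj₁ (i , j , p) = suc i , suc j , p
    -- Without a spread pair the n - 1 representatives other than `f zero` would be pairwise close.
    ... | inj₂ c = ⊥-elim (Rook.absurd (f ∘ suc) 4≤m (n<1+n _) (c _ _))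

    contradict : ⊥
    contradict with scattered
    ... | i , j , i≢j , e , g , e-g , ei , gj with fresh (i ∷ j ∷ []) (s≤s (s≤s (≤-trans (s≤s z≤n) 4≤m)))
    ...   | k , k∉ with third-is-close e g (f k) e-g (distinct i≢j e g e-g ei gj k≢i k≢j)
      where
      k≢i : k ≢ i
      k≢i refl = k∉ 1st
      k≢j : k ≢ j
      k≢j refl = k∉ 2nd
    ...     | inj₁ c = one-sided i≢j e g e-g ei gj (λ { refl → k∉ 1st }) (λ { refl → k∉ 2nd }) c
    ...     | inj₂ c = one-sided (≢-sym i≢j) g e (Apart-sym {e = e} {g} e-g) gj ei (λ { refl → k∉ 2nd }) (λ { refl → k∉ 1st }) c

-- Extremal colourings

-- If j were at most k, restricting the k representatives to j of them would force a rainbow copy.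
fewer-colours : ∀ {n G k} (χ : Colouring n) → UsesAtLeast χ k → ¬ HasRainbowCopy χ G →
                ∀ j → Forces n G j → suc k ≤ j
fewer-colours χ (f , inj) free j F = ≮⇒≥ λ j<1+k → let j≤k = s≤s⁻¹ j<1+k in
  free (F χ (f ∘ (λ i → inject≤ i j≤k) , λ i l e → inject≤-injective j≤k j≤k i l (inj _ _ e)))

two-valued : ∀ {a b c k : ℕ} → a ≡ 0 ⊎ a ≡ k → b ≡ 0 ⊎ b ≡ k → c ≡ 0 ⊎ c ≡ k → ¬ Unique (a ∷ b ∷ c ∷ [])
two-valued (inj₁ refl) (inj₁ refl) _ ((n ∷ _) ∷ _) = n refl
two-valued (inj₂ refl) (inj₂ refl) _ ((n ∷ _) ∷ _) = n refl
two-valued (inj₁ refl) _ (inj₁ refl) ((_ ∷ n ∷ _) ∷ _) = n refl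
two-valued (inj₂ refl) _ (inj₂ refl) ((_ ∷ n ∷ _) ∷ _) = n refl
two-valued _ (inj₁ refl) (inj₁ refl) (_ ∷ (n ∷ _) ∷ _) = n refl
two-valued _ (inj₂ refl) (inj₂ refl) (_ ∷ (n ∷ _) ∷ _) = n refl

-- The successor separates the colours of the blocks from 0, the common colour of all other triples.
agreement : ℕ → ℕ → ℕ → ℕ
agreement x y z with x ≟ℕ y | x ≟ℕ z
... | yes _ | yes _ = suc x
... | _     | _     = 0

agreement-refl : ∀ x → agreement x x x ≡ suc x
agreement-refl x with x ≟ℕ x
... | yes _ = refl
... | no n  = contradiction refl n

agreement-values : ∀ x y z → (x ≡ y × y ≡ z × agreement x y z ≡ suc x) ⊎ (¬ (x ≡ y × y ≡ z) × agreement x y z ≡ 0)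
agreement-values x y z with x ≟ℕ y | x ≟ℕ z
... | yes refl | yes refl = inj₁ (refl , refl , refl)
... | yes refl | no n     = inj₂ ((λ { (_ , e) → n e }) , refl)
... | no n     | _        = inj₂ ((λ { (e , _) → n e }) , refl)

agreement-swap₁₂ : ∀ x y z → agreement x y z ≡ agreement y x z
agreement-swap₁₂ x y z with agreement-values x y z | agreement-values y x z
... | inj₁ (refl , refl , e) | _ = refl
... | inj₂ (_ , e) | inj₂ (_ , e′) = trans e (sym e′)
... | inj₂ (n , _) | inj₁ (refl , refl , _) = contradiction (refl , refl) n

agreement-swap₂₃ : ∀ x y z → agreement x y z ≡ agreement x z y
agreement-swap₂₃ x y z with agreement-values x y z | agreement-values x z y
... | inj₁ (refl , refl , e) | _ = refl
... | inj₂ (_ , e) | inj₂ (_ , e′) = trans e (sym e′)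
... | inj₂ (n , _) | inj₁ (refl , refl , _) = contradiction (refl , refl) n

agreement-with : ∀ x y z {w} → w ∈ x ∷ y ∷ z ∷ [] → agreement x y z ≡ 0 ⊎ agreement x y z ≡ suc w
agreement-with x y z w∈ with agreement-values x y z
... | inj₂ (_ , e) = inj₁ e
agreement-with x y z 1st | inj₁ (refl , refl , e) = inj₂ e
agreement-with x y z 2nd | inj₁ (refl , refl , e) = inj₂ e
agreement-with x y z 3rd | inj₁ (refl , refl , e) = inj₂ e

-- Vertices are grouped in consecutive threes, and each full group is an edge with a colour of its
-- own.
blocks : ∀ n → Colouring n
blocks n = record
  { col    = λ a b c → agreement (toℕ a / 3) (toℕ b / 3) (toℕ c / 3)
  ; swap12 = λ _ _ _ → agreement-swap₁₂ _ _ _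
  ; swap23 = λ _ _ _ → agreement-swap₂₃ _ _ _ }

blocks-free : ∀ n → ¬ HasRainbowCopy (blocks n) tightPath
blocks-free n (φ , _ , u) = two-valued
  -- Vertex 2 lies in all three edges, so its block determines the only nonzero colour they can
  -- have.
  (agreement-with (β (# 0)) (β (# 1)) (β (# 2)) 3rd)
  (agreement-with (β (# 1)) (β (# 2)) (β (# 3)) 2nd)
  (agreement-with (β (# 2)) (β (# 3)) (β (# 4)) 1st) u
  where
  β : Fin 5 → ℕ
  β v = toℕ (φ v) / 3

offset : ∀ r i → r <ℕ 3 → (r + i * 3) / 3 ≡ i
offset r i r<3 = trans (+-distrib-/-∣ʳ r (divides i refl)) (small r r<3)
  where
  small : ∀ r → r <ℕ 3 → r / 3 + i * 3 / 3 ≡ i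
  small 0 _ = m*n/n≡m i 3
  small 1 _ = m*n/n≡m i 3
  small 2 _ = m*n/n≡m i 3
  small (suc (suc (suc _))) (s≤s (s≤s (s≤s ())))

blocks-colours : ∀ m → UsesAtLeast (blocks (5 + m)) (suc ((5 + m) / 3))
blocks-colours m = f , inj
  where
  n = 5 + m
  vertex : ∀ r (i : Fin (n / 3)) → r <ℕ 3 → r + toℕ i * 3 <ℕ n
  vertex r i r<3 = <-≤-trans (+-monoˡ-< (toℕ i * 3) r<3)
    (≤-trans (*-monoˡ-≤ 3 (toℕ<n i)) (m/n*n≤m n 3))
  point : ∀ r i → r <ℕ 3 → Fin n
  point r i r<3 = fromℕ< (vertex r i r<3)
  toℕ-point : ∀ r i r<3 → toℕ (point r i r<3) ≡ r + toℕ i * 3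
  toℕ-point r i r<3 = toℕ-fromℕ< (vertex r i r<3)
  block-point : ∀ r i r<3 → toℕ (point r i r<3) / 3 ≡ toℕ i
  block-point r i r<3 = trans (cong (_/ 3) (toℕ-point r i r<3)) (offset r (toℕ i) r<3)
  distinct : ∀ r s i {r<3 s<3} → r ≢ s → point r i r<3 ≢ point s i s<3
  distinct r s i {r<3} {s<3} r≢s e = r≢s (+-cancelʳ-≡ (toℕ i * 3) r s
    (trans (sym (toℕ-point r i r<3)) (trans (cong toℕ e) (toℕ-point s i s<3))))
  0<3 = s≤s {n = 2} z≤n
  1<3 = s≤s (s≤s {n = 1} z≤n)
  2<3 = s≤s (s≤s (s≤s {n = 0} z≤n))
  f : Fin (suc (n / 3)) → DTriple n
  -- This triple straddles two blocks and represents the colour 0.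
  f zero    = dtriple (# 0) (# 1) (# 3) (λ ()) (λ ()) (λ ())
  f (suc i) = dtriple (point 0 i 0<3) (point 1 i 1<3) (point 2 i 2<3)
                (distinct 0 1 i {0<3} {1<3} λ ()) (distinct 0 2 i {0<3} {2<3} λ ()) (distinct 1 2 i {1<3} {2<3} λ ())
  colour-f : ∀ i → colOf (blocks n) (f i) ≡ toℕ i
  colour-f zero    = refl
  colour-f (suc i) = trans (cong₃ agreement (block-point 0 i 0<3) (block-point 1 i 1<3) (block-point 2 i 2<3))
                           (agreement-refl (toℕ i))
  inj : ∀ i j → colOf (blocks n) (f i) ≡ colOf (blocks n) (f j) → i ≡ j
  inj i j e = toℕ-injective (trans (sym (colour-f i)) (trans e (colour-f j)))

has : ℕ → ℕ → ℕ → ℕ → Bool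
has x a b c = (a ≡ᵇ x) ∨ ((b ≡ᵇ x) ∨ (c ≡ᵇ x))

has-swap₁₂ : ∀ x a b c → has x a b c ≡ has x b a c
has-swap₁₂ x a b c with a ≡ᵇ x | b ≡ᵇ x
... | true  | true  = refl
... | true  | false = refl
... | false | true  = refl
... | false | false = refl

has-swap₂₃ : ∀ x a b c → has x a b c ≡ has x a c b
has-swap₂₃ x a b c = cong ((a ≡ᵇ x) ∨_) (∨-comm (b ≡ᵇ x) (c ≡ᵇ x))

has⇒∈ : ∀ {x} a b c → T (has x a b c) → x ∈ a ∷ b ∷ c ∷ []
has⇒∈ {x} a b c h with Equivalence.to (T-∨ {a ≡ᵇ x}) h
... | inj₁ p = here (sym (≡ᵇ⇒≡ a x p))
... | inj₂ h′ with Equivalence.to (T-∨ {b ≡ᵇ x}) h′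
...   | inj₁ p = there (here (sym (≡ᵇ⇒≡ b x p)))
...   | inj₂ p = there (there (here (sym (≡ᵇ⇒≡ c x p))))

star : ∀ n → Colouring n
star n = record
  { col    = λ a b c → if has 0 (toℕ a) (toℕ b) (toℕ c) then 1 else 0
  ; swap12 = λ a b c → cong (if_then 1 else 0) (has-swap₁₂ 0 (toℕ a) (toℕ b) (toℕ c))
  ; swap23 = λ a b c → cong (if_then 1 else 0) (has-swap₂₃ 0 (toℕ a) (toℕ b) (toℕ c)) }

star-free : ∀ n → ¬ HasRainbowCopy (star n) messyPath
star-free n (φ , _ , u) = two-valued {k = 1} (binary (h (# 0) (# 1) (# 2))) (binary (h (# 1) (# 2) (# 3))) (binary (h (# 3) (# 4) (# 5))) u
  where
  h : (a b c : Fin 6) → Bool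
  h a b c = has 0 (toℕ (φ a)) (toℕ (φ b)) (toℕ (φ c))
  binary : ∀ b → (if b then 1 else 0) ≡ 0 ⊎ (if b then 1 else 0) ≡ 1
  binary true  = inj₂ refl
  binary false = inj₁ refl

star-colours : ∀ n → 7 ≤ n → UsesAtLeast (star n) 2
star-colours (suc (suc (suc (suc n)))) _ = f , inj
  where
  f : Fin 2 → DTriple (4 + n)
  f zero       = dtriple (# 0) (# 1) (# 2) (λ ()) (λ ()) (λ ())
  f (suc zero) = dtriple (# 1) (# 2) (# 3) (λ ()) (λ ()) (λ ())
  inj : ∀ i j → colOf (star (4 + n)) (f i) ≡ colOf (star (4 + n)) (f j) → i ≡ j
  inj zero       zero       _ = refl
  inj (suc zero) (suc zero) _ = refl
  inj zero       (suc zero) ()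
  inj (suc zero) zero       ()
star-colours (suc zero) (s≤s ())
star-colours (suc (suc zero)) (s≤s (s≤s ()))
star-colours (suc (suc (suc zero))) (s≤s (s≤s (s≤s ())))

complementary : Colouring 6
complementary = record
  { col    = λ a b c → fold ((2 ^ toℕ a + 2 ^ toℕ b) + 2 ^ toℕ c)
  ; swap12 = λ a b c → cong (λ s → fold (s + 2 ^ toℕ c)) (+-comm (2 ^ toℕ a) (2 ^ toℕ b))
  ; swap23 = λ a b c → cong fold (trans (+-assoc (2 ^ toℕ a) (2 ^ toℕ b) (2 ^ toℕ c))
      (trans (cong (2 ^ toℕ a +_) (+-comm (2 ^ toℕ b) (2 ^ toℕ c))) (sym (+-assoc (2 ^ toℕ a) (2 ^ toℕ c) (2 ^ toℕ b))))) }
  where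
  -- Subsets of Fin 6 are coded in binary, so complementation is s ↦ 63 ∸ s.
  fold : ℕ → ℕ
  fold s = s ⊓ (63 ∸ s)

complement-colour : ∀ (a b c d e f : Fin 6) → Unique (a ∷ b ∷ c ∷ d ∷ e ∷ f ∷ []) →
                    col complementary a b c ≡ col complementary d e f
complement-colour a b c d e f ((ab ∷ ac ∷ ad ∷ ae ∷ af ∷ []) ∷ (bc ∷ bd ∷ be ∷ bf ∷ []) ∷ (cd ∷ ce ∷ cf ∷ []) ∷
                               (de ∷ df ∷ []) ∷ (ef ∷ []) ∷ _) =
  toWitness {a? = decide} tt a b ab c ac bc d ad bd cd e ae be ce de f af bf cf df ef
  where
  decide : Dec (∀ a b → a ≢ b → ∀ c → a ≢ c → b ≢ c → ∀ d → a ≢ d → b ≢ d → c ≢ d →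
                ∀ e → a ≢ e → b ≢ e → c ≢ e → d ≢ e → ∀ f → a ≢ f → b ≢ f → c ≢ f → d ≢ f → e ≢ f →
                col complementary a b c ≡ col complementary d e f)
  -- Inequations come directly after each new vertex, so repeated vertices are pruned before the
  -- next quantifier.
  decide = all? λ a → all? λ b → a ≠ b ⇒ (all? λ c → a ≠ c ⇒ b ≠ c ⇒ (all? λ d → a ≠ d ⇒ b ≠ d ⇒ c ≠ d ⇒
    (all? λ e → a ≠ e ⇒ b ≠ e ⇒ c ≠ e ⇒ d ≠ e ⇒ (all? λ f → a ≠ f ⇒ b ≠ f ⇒ c ≠ f ⇒ d ≠ f ⇒ e ≠ f ⇒
      (col complementary a b c ≟ℕ col complementary d e f)))))
    where
    infixr 1 _≠_⇒_
    _≠_⇒_ : ∀ (i j : Fin 6) {A : Set} → Dec A → Dec (i ≢ j → A)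
    i ≠ j ⇒ A? = ¬? (i ≟F j) →-dec A?

-- The first and last edges of a messy path partition the six vertices, so they share a colour.
complementary-free : ¬ HasRainbowCopy complementary messyPath
complementary-free (φ , inj , (_ ∷ n ∷ []) ∷ _) = n (complement-colour _ _ _ _ _ _
  ((ne (λ ()) ∷ ne (λ ()) ∷ ne (λ ()) ∷ ne (λ ()) ∷ ne (λ ()) ∷ []) ∷ (ne (λ ()) ∷ ne (λ ()) ∷ ne (λ ()) ∷ ne (λ ()) ∷ []) ∷
   (ne (λ ()) ∷ ne (λ ()) ∷ ne (λ ()) ∷ []) ∷ (ne (λ ()) ∷ ne (λ ()) ∷ []) ∷ (ne (λ ()) ∷ []) ∷ [] ∷ []))
  where
  ne : ∀ {i j} → i ≢ j → φ i ≢ φ j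
  ne i≢j e = i≢j (inj e)

complementary-colours : UsesAtLeast complementary 10
complementary-colours = Vec.lookup halves , toWitness {a? = decide} tt
  where
  decide : Dec (∀ i j → colOf complementary (Vec.lookup halves i) ≡ colOf complementary (Vec.lookup halves j) → i ≡ j)
  decide = all? λ i → all? λ j →
    (colOf complementary (Vec.lookup halves i) ≟ℕ colOf complementary (Vec.lookup halves j)) →-dec (i ≟F j)

-- A triple through 0 and 1 gets its vertex sum: symmetric, nonzero, and determined by the third
-- vertex. All other triples get 0.
pencil : ∀ n → Colouring n
pencil n = record
  { col    = λ a b c → paint (toℕ a) (toℕ b) (toℕ c)
  ; swap12 = λ a b c → paint-cong (has-swap₁₂ 0 (toℕ a) (toℕ b) (toℕ c)) (has-swap₁₂ 1 (toℕ a) (toℕ b) (toℕ c))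
                         (cong (_+ toℕ c) (+-comm (toℕ a) (toℕ b)))
  ; swap23 = λ a b c → paint-cong (has-swap₂₃ 0 (toℕ a) (toℕ b) (toℕ c)) (has-swap₂₃ 1 (toℕ a) (toℕ b) (toℕ c))
                         (trans (+-assoc (toℕ a) (toℕ b) (toℕ c))
                           (trans (cong (toℕ a +_) (+-comm (toℕ b) (toℕ c))) (sym (+-assoc (toℕ a) (toℕ c) (toℕ b))))) }
  where
  paint : ℕ → ℕ → ℕ → ℕ
  paint a b c = if has 0 a b c ∧ has 1 a b c then (a + b) + c else 0
  paint-cong : ∀ {p p′ q q′ s s′} → p ≡ p′ → q ≡ q′ → s ≡ s′ →
               (if p ∧ q then s else 0) ≡ (if p′ ∧ q′ then s′ else 0)
  paint-cong refl refl refl = refl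

pencil-values : ∀ {n} (a b c : Fin n) → let xs = toℕ a ∷ toℕ b ∷ toℕ c ∷ [] in
                col (pencil n) a b c ≡ 0 ⊎ (0 ∈ xs × 1 ∈ xs)
pencil-values a b c with has 0 (toℕ a) (toℕ b) (toℕ c) in e₀ | has 1 (toℕ a) (toℕ b) (toℕ c) in e₁
... | false | _     = inj₁ refl
... | true  | false = inj₁ refl
... | true  | true  = inj₂ (has⇒∈ (toℕ a) (toℕ b) (toℕ c) (subst T (sym e₀) tt) ,
                            has⇒∈ (toℕ a) (toℕ b) (toℕ c) (subst T (sym e₁) tt))

one-overlap : ∀ {A : Set} {f : A → ℕ} → Injective _≡_ _≡_ f → ∀ {xs ys x} → (∀ {v} → v ∈ xs → v ∈ ys → v ≡ x) →
              0 ∈ map f xs × 1 ∈ map f xs → 0 ∈ map f ys × 1 ∈ map f ys → ⊥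
one-overlap {f = f} inj only (p , q) (p′ , q′)
  with ∈-map⁻ f p | ∈-map⁻ f q | ∈-map⁻ f p′ | ∈-map⁻ f q′
... | v , v∈ , e | w , w∈ , d | v′ , v∈′ , e′ | w′ , w∈′ , d′
  with inj (trans (sym e) e′) | inj (trans (sym d) d′)
... | refl | refl with only v∈ v∈′ | only w∈ w∈′
...   | refl | refl with trans e (sym d)
...     | ()

-- Two edges of a loose path share at most one vertex, so at most one edge contains both 0 and 1,
-- and the other two have colour 0.
pencil-free : ∀ n → ¬ HasRainbowCopy (pencil n) loosePath
pencil-free n (φ , inj , (ab ∷ ac ∷ []) ∷ (bc ∷ []) ∷ _)
  with pencil-values (φ (# 0)) (φ (# 1)) (φ (# 2)) | pencil-values (φ (# 2)) (φ (# 3)) (φ (# 4))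
     | pencil-values (φ (# 4)) (φ (# 5)) (φ (# 6))
... | inj₁ p | inj₁ q | _      = ab (trans p (sym q))
... | inj₁ p | _      | inj₁ q = ac (trans p (sym q))
... | _      | inj₁ p | inj₁ q = bc (trans p (sym q))
... | inj₂ p | inj₂ q | _      = one-overlap {f = toℕ ∘ φ} (inj ∘ toℕ-injective)
  {# 0 ∷ # 1 ∷ # 2 ∷ []} {# 2 ∷ # 3 ∷ # 4 ∷ []} {# 2}
  (λ { 3rd 1st → refl ; 1st (there (there (there ()))) ; 2nd (there (there (there ()))) ; 3rd (there (there (there ()))) }) p q
-- The first and last edges are disjoint, so the vertex 0 given as their only possible overlap is an
-- arbitrary choice.
... | inj₂ p | _      | inj₂ q = one-overlap {f = toℕ ∘ φ} (inj ∘ toℕ-injective)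
  {# 0 ∷ # 1 ∷ # 2 ∷ []} {# 4 ∷ # 5 ∷ # 6 ∷ []} {# 0}
  (λ { 1st (there (there (there ()))) ; 2nd (there (there (there ()))) ; 3rd (there (there (there ()))) }) p q
... | _      | inj₂ p | inj₂ q = one-overlap {f = toℕ ∘ φ} (inj ∘ toℕ-injective)
  {# 2 ∷ # 3 ∷ # 4 ∷ []} {# 4 ∷ # 5 ∷ # 6 ∷ []} {# 4}
  (λ { 3rd 1st → refl ; 1st (there (there (there ()))) ; 2nd (there (there (there ()))) ; 3rd (there (there (there ()))) }) p q

pencil-colours : ∀ m → UsesAtLeast (pencil (5 + m)) (4 + m)
pencil-colours m = f , inj
  where
  f : Fin (4 + m) → DTriple (5 + m)
  f zero    = dtriple (# 2) (# 3) (# 4) (λ ()) (λ ()) (λ ())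
  f (suc i) = dtriple (# 0) (# 1) (suc (suc i)) (λ ()) (λ ()) (λ ())
  inj : ∀ i j → colOf (pencil (5 + m)) (f i) ≡ colOf (pencil (5 + m)) (f j) → i ≡ j
  inj zero    zero    _ = refl
  -- The colour of the triple 0, 1, 2 + i is 3 + i, whence the cancelled 3.
  inj (suc i) (suc j) e = cong suc (toℕ-injective (+-cancelˡ-≡ 3 _ _ e))

-- Combining the upper bounds with the extremal colourings

tight-ar : ∀ n → 5 ≤ n → ArEq n tightPath (2 + n / 3)
tight-ar n 5≤n with m≤n⇒∃[o]m+o≡n 5≤n
... | m , refl = tight-upper 5≤n n<3k , fewer-colours (blocks n) (blocks-colours m) (blocks-free n)
  where
  n<3k : n <ℕ suc (n / 3) * 3
  n<3k = subst (_<ℕ suc (n / 3) * 3) (sym (m≡m%n+[m/n]*n n 3)) (+-monoˡ-< (n / 3 * 3) (m%n<n n 3))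

loose-ar : ∀ n → 7 ≤ n → ArEq n loosePath n
loose-ar n 7≤n with m≤n⇒∃[o]m+o≡n 7≤n
-- On n = 5 + (2 + m) vertices the pencil uses n - 1 colours.
... | m , refl = loose-upper 7≤n , fewer-colours (pencil n) (pencil-colours (2 + m)) (pencil-free n)

theorem1p12 : ((n : ℕ) → 5 ≤ n → ArEq n tightPath (n / 3 + 2))
    × (ArEq 6 messyPath 11 × ((n : ℕ) → 7 ≤ n → ArEq n messyPath 3))
    × ((n : ℕ) → 7 ≤ n → ArEq n loosePath n)
theorem1p12 =
  (λ n 5≤n → subst (ArEq n tightPath) (+-comm 2 (n / 3)) (tight-ar n 5≤n)) ,
  ((messy-upper₆ , fewer-colours complementary complementary-colours complementary-free) ,
   λ n 7≤n → messy-upper 7≤n , fewer-colours (star n) (star-colours n 7≤n) (star-free n)) ,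
  loose-ar
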